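{- Let $q$ be a prime power and let $a,b\ge 2$ be integers. If $J_q(a;b)$ is DOT, then $J_q(a';b)$ is DOT for all integers $a'\ge a$.
   Context: $J_q(n,k)$ is the set of all $k$-dimensional subspaces of $\mathbb{F}_q^n$, and $J_q(a;b)$ denotes $J_q(a+b,b)$. A point is a one-dimensional subspace of $\mathbb{F}_q^n$. A function $f\colon J_q(n,k)\to\mathbb{R}$ is Boolean if $f(V)\in\{0,1\}$ for all $V$, and has degree one if $f=\sum_p c_p x_p$ for some real coefficients $c_p$, where the sum is over all points $p$ and $x_p(V)=1$ if $p\subseteq V$, $x_p(V)=0$ otherwise. For a point $r$, $y_r(V)=1$ if $V$ is orthogonal to $r$ (i.e. $V\subseteq r^\perp$), and $y_r(V)=0$ otherwise; orthogonality is with respect to the standard bilinear form on $\mathbb{F}_q^n$. A Boolean degree one function on $J_q(n,k)$ is trivial if it is one of $0,\ 1,\ x_p,\ 1-x_p,\ y_r,\ 1-y_r,\ x_p+y_r,\ 1-x_p-y_r$ for some points $p,r$, where in the last two cases $p\not\perp r$. $J_q(n,k)$ is degree-one trivial (DOT) if all Boolean degree one functions on $J_q(n,k)$ are trivial. -}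

module Defs where

open import Algebra.Apartness.Structures using (IsHeytingField)
open import Algebra.Bundles using (CommutativeRing)
open import Algebra.Core using (Op₁; Op₂)
import Algebra.Properties.Ring as RingProperties
open import Data.Fin.Base using (Fin)
import Data.Fin.Properties as Fin
open import Data.List.Base as List using (List; []; _∷_)
open import Data.List.Membership.Propositional using (_∈_)
open import Data.List.Membership.Propositional.Properties using (∈-allFin; ∈-map⁺; ∈-cartesianProductWith⁺)
open import Data.List.Relation.Unary.Any using (here; there)
open import Data.List.Relation.Unary.Enumerates.Setoid using (IsEnumeration)
import Data.List.Relation.Unary.Enumerates.Setoid.Properties as Enumerates
import Data.List.Relation.Unary.Unique.Setoid as UniqueSetoid
import Data.List.Relation.Unary.Unique.DecSetoid.Properties as UniqueDec
import Data.List.Membership.Setoid as SetoidMembership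
open import Data.Nat.Base as ℕ using (ℕ; zero; suc)
import Data.Nat.Properties as ℕ
open import Data.Nat.Primality using (Prime)
open import Data.Product.Base using (Σ; ∃; ∃₂; _×_; _,_; proj₁; proj₂)
open import Data.Bool.Base using (if_then_else_)
open import Data.Rational.Base as ℚ using (ℚ; 0ℚ; 1ℚ; ½)
import Data.Rational.Properties as ℚ
open import Data.Rational.Solver using (module +-*-Solver)
open import Data.Sum.Base using (_⊎_)
open import Data.Vec.Base as Vec using (Vec; []; _∷_)
import Data.Vec.Properties as Vec
open import Data.Vec.Relation.Unary.All using (All; []; _∷_)
open import Function.Base using (_∘_)
open import Function.Bundles using (Func; _↔_; module Inverse)
open import Function.Properties.Inverse using (↔⇒↣)
open import Level as Level using (0ℓ)
open import Relation.Binary.Bundles using (Setoid; DecSetoid)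
open import Relation.Binary.Definitions using (DecidableEquality)
open import Relation.Binary.PropositionalEquality as ≡
  using (_≡_; _≢_; refl; sym; trans; cong; cong₂; subst)
open import Relation.Nullary using (¬_; Dec; yes; no; does; contradiction)
open import Relation.Nullary.Decidable using (map′; via-injection; _→-dec_; _×-dec_)
open import Relation.Unary using (Pred; Decidable)

PrimePower : ℕ → Set
PrimePower q = ∃₂ λ p m → Prime p × 1 ℕ.≤ m × q ≡ p ℕ.^ m

-- Real numbers are Cauchy sequences of rationals; two are equal when
-- their difference tends to 0.

IsCauchy : (ℕ → ℚ) → Set
IsCauchy x = ∀ ε → 0ℚ ℚ.< ε →
  ∃ λ N → ∀ m n → N ℕ.≤ m → N ℕ.≤ n → ℚ.∣ x m ℚ.- x n ∣ ℚ.< ε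

record ℝ : Set where
  constructor mkℝ
  field
    seq    : ℕ → ℚ
    cauchy : IsCauchy seq

open ℝ public

infix 4 _≈_

record _≈_ (x y : ℝ) : Set where
  constructor mk≈
  field
    close : ∀ ε → 0ℚ ℚ.< ε →
            ∃ λ N → ∀ n → N ℕ.≤ n → ℚ.∣ seq x n ℚ.- seq y n ∣ ℚ.< ε

open _≈_ public

private
  half>0 : ∀ {ε} → 0ℚ ℚ.< ε → 0ℚ ℚ.< ½ ℚ.* ε
  half>0 {ε} 0<ε = subst (ℚ._< ½ ℚ.* ε) (ℚ.*-zeroʳ ½) (ℚ.*-monoʳ-<-pos ½ 0<ε)

  halves : ∀ ε → ½ ℚ.* ε ℚ.+ ½ ℚ.* ε ≡ ε
  halves ε = trans (sym (ℚ.*-distribʳ-+ ε ½ ½)) (ℚ.*-identityˡ ε)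

  ∣+∣< : ∀ {p q} ε → ℚ.∣ p ∣ ℚ.< ½ ℚ.* ε → ℚ.∣ q ∣ ℚ.< ½ ℚ.* ε →
         ℚ.∣ p ℚ.+ q ∣ ℚ.< ε
  ∣+∣< {p} {q} ε p< q< = ℚ.≤-<-trans (ℚ.∣p+q∣≤∣p∣+∣q∣ p q)
    (subst (_ ℚ.<_) (halves ε) (ℚ.+-mono-< p< q<))

  ∣0∣< : ∀ {ε} p → 0ℚ ℚ.< ε → ℚ.∣ p ℚ.- p ∣ ℚ.< ε
  ∣0∣< p 0<ε = subst (λ d → ℚ.∣ d ∣ ℚ.< _) (sym (ℚ.+-inverseʳ p)) 0<ε

  ∣∣-swap : ∀ p q → ℚ.∣ p ℚ.- q ∣ ≡ ℚ.∣ q ℚ.- p ∣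
  ∣∣-swap p q = trans (sym (ℚ.∣-p∣≡∣p∣ (p ℚ.- q)))
    (cong ℚ.∣_∣ (solve 2 (λ p q → :- (p :- q) := q :- p) refl p q))
    where open +-*-Solver

  ∣*∣< : ∀ {p q b} δ → ℚ.∣ p ∣ ℚ.< b → ℚ.∣ q ∣ ℚ.< δ → ℚ.∣ p ℚ.* q ∣ ℚ.< b ℚ.* δ
  ∣*∣< {p} {q} {b} δ p<b q<δ = begin-strict
    ℚ.∣ p ℚ.* q ∣          ≡⟨ ℚ.∣p*q∣≡∣p∣*∣q∣ p q ⟩
    ℚ.∣ p ∣ ℚ.* ℚ.∣ q ∣    ≤⟨ ℚ.*-monoʳ-≤-nonNeg ℚ.∣ q ∣ {{ℚ.∣-∣-nonNeg q}} (ℚ.<⇒≤ p<b) ⟩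
    b ℚ.* ℚ.∣ q ∣          <⟨ ℚ.*-monoʳ-<-pos b {{ℚ.positive (ℚ.≤-<-trans (ℚ.0≤∣p∣ p) p<b)}} q<δ ⟩
    b ℚ.* δ                ∎
    where open ℚ.≤-Reasoning

  shrink : ∀ b ε → 0ℚ ℚ.< b → 0ℚ ℚ.< ε → ∃ λ δ → 0ℚ ℚ.< δ × b ℚ.* δ ≡ ε
  shrink b ε 0<b 0<ε =
      b⁻¹ ℚ.* ε
    , subst (ℚ._< b⁻¹ ℚ.* ε) (ℚ.*-zeroʳ b⁻¹) (ℚ.*-monoʳ-<-pos b⁻¹ {{ℚ.1/pos⇒pos b}} 0<ε)
    , trans (sym (ℚ.*-assoc b b⁻¹ ε))
        (trans (cong (ℚ._* ε) (ℚ.*-inverseʳ b)) (ℚ.*-identityˡ ε))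
    where
    instance
      b-pos = ℚ.positive 0<b
      b≢0   = ℚ.pos⇒nonZero b
    b⁻¹ = ℚ.1/ b

  eventually-bounded : ∀ {x} → IsCauchy x →
    ∃₂ λ b N → 0ℚ ℚ.< b × (∀ n → N ℕ.≤ n → ℚ.∣ x n ∣ ℚ.< b)
  eventually-bounded {x} x-cauchy =
    b , N , ℚ.≤-<-trans (ℚ.0≤∣p∣ (x N)) (bound N ℕ.≤-refl) , bound
    where
    N = proj₁ (x-cauchy 1ℚ (ℚ.positive⁻¹ 1ℚ))
    b = 1ℚ ℚ.+ ℚ.∣ x N ∣
    bound : ∀ n → N ℕ.≤ n → ℚ.∣ x n ∣ ℚ.< b
    bound n N≤n = begin-strict
      ℚ.∣ x n ∣                         ≡⟨ cong ℚ.∣_∣ (solve 2 (λ p q → p := (p :- q) :+ q) refl (x n) (x N)) ⟩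
      ℚ.∣ (x n ℚ.- x N) ℚ.+ x N ∣       ≤⟨ ℚ.∣p+q∣≤∣p∣+∣q∣ (x n ℚ.- x N) (x N) ⟩
      ℚ.∣ x n ℚ.- x N ∣ ℚ.+ ℚ.∣ x N ∣   <⟨ ℚ.+-monoˡ-< ℚ.∣ x N ∣ (proj₂ (x-cauchy 1ℚ (ℚ.positive⁻¹ 1ℚ)) n N N≤n ℕ.≤-refl) ⟩
      b                                 ∎
      where
      open ℚ.≤-Reasoning
      open +-*-Solver

  upperˡ : ∀ {N M n} → N ℕ.⊔ M ℕ.≤ n → N ℕ.≤ n
  upperˡ = ℕ.m⊔n≤o⇒m≤o _ _

  upperʳ : ∀ {N M n} → N ℕ.⊔ M ℕ.≤ n → M ℕ.≤ n
  upperʳ = ℕ.m⊔n≤o⇒n≤o _ _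

ℝ-setoid : Setoid 0ℓ 0ℓ
ℝ-setoid = record
  { Carrier       = ℝ
  ; _≈_           = _≈_
  ; isEquivalence = record
    { refl  = λ {x} → mk≈ λ ε 0<ε → 0 , λ n _ → ∣0∣< (seq x n) 0<ε
    ; sym   = λ {x} {y} x≈y → mk≈ λ ε 0<ε →
        let N , h = close x≈y ε 0<ε in
        N , λ n N≤n → subst (ℚ._< ε) (∣∣-swap (seq x n) (seq y n)) (h n N≤n)
    ; trans = λ {x} {y} {z} x≈y y≈z → mk≈ λ ε 0<ε →
        let N , h = close x≈y _ (half>0 0<ε)
            M , k = close y≈z _ (half>0 0<ε)
        in N ℕ.⊔ M , λ n ≤n →
          subst (λ d → ℚ.∣ d ∣ ℚ.< ε)
            (telescope (seq x n) (seq y n) (seq z n))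
            (∣+∣< ε (h n (upperˡ ≤n)) (k n (upperʳ {N} ≤n)))
    }
  }
  where
  open +-*-Solver
  telescope : ∀ p q r → (p ℚ.- q) ℚ.+ (q ℚ.- r) ≡ p ℚ.- r
  telescope = solve 3 (λ p q r → (p :- q) :+ (q :- r) := p :- r) refl

fromℚ : ℚ → ℝ
fromℚ p = mkℝ (λ _ → p) λ ε 0<ε → 0 , λ _ _ _ _ → ∣0∣< p 0<ε

0ℝ 1ℝ : ℝ
0ℝ = fromℚ 0ℚ
1ℝ = fromℚ 1ℚ

infixl 6 _+_ _-_
infixl 7 _*_
infix  8 -_

_+_ : ℝ → ℝ → ℝ
x + y = mkℝ (λ n → seq x n ℚ.+ seq y n) λ ε 0<ε →
  let N , h = cauchy x _ (half>0 0<ε)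
      M , k = cauchy y _ (half>0 0<ε)
  in N ℕ.⊔ M , λ m n ≤m ≤n →
    subst (λ d → ℚ.∣ d ∣ ℚ.< ε)
      (regroup (seq x m) (seq x n) (seq y m) (seq y n))
      (∣+∣< ε (h m n (upperˡ ≤m) (upperˡ ≤n)) (k m n (upperʳ {N} ≤m) (upperʳ {N} ≤n)))
  where
  open +-*-Solver
  regroup : ∀ p p′ q q′ → (p ℚ.- p′) ℚ.+ (q ℚ.- q′) ≡ (p ℚ.+ q) ℚ.- (p′ ℚ.+ q′)
  regroup = solve 4 (λ p p′ q q′ → (p :- p′) :+ (q :- q′) := (p :+ q) :- (p′ :+ q′)) refl

-_ : ℝ → ℝ
- x = mkℝ (λ n → ℚ.- seq x n) λ ε 0<ε →
  let N , h = cauchy x ε 0<ε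
  in N , λ m n N≤m N≤n →
    subst (λ d → ℚ.∣ d ∣ ℚ.< ε) (flip-sign (seq x m) (seq x n)) (h n m N≤n N≤m)
  where
  open +-*-Solver
  flip-sign : ∀ p q → q ℚ.- p ≡ (ℚ.- p) ℚ.- (ℚ.- q)
  flip-sign = solve 2 (λ p q → q :- p := (:- p) :- (:- q)) refl

_-_ : ℝ → ℝ → ℝ
x - y = x + - y

_*_ : ℝ → ℝ → ℝ
x * y = mkℝ (λ n → seq x n ℚ.* seq y n) λ ε 0<ε →
  let bx , Nx , 0<bx , x<bx = eventually-bounded (cauchy x)
      by , Ny , 0<by , y<by = eventually-bounded (cauchy y)
      δy , 0<δy , bxδy≡ = shrink bx (½ ℚ.* ε) 0<bx (half>0 0<ε)
      δx , 0<δx , byδx≡ = shrink by (½ ℚ.* ε) 0<by (half>0 0<ε)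
      Mx , hx = cauchy x δx 0<δx
      My , hy = cauchy y δy 0<δy
  in (Nx ℕ.⊔ Ny) ℕ.⊔ (Mx ℕ.⊔ My) , λ m n ≤m ≤n →
    subst (λ d → ℚ.∣ d ∣ ℚ.< ε)
      (regroup (seq x m) (seq x n) (seq y m) (seq y n))
      (∣+∣< ε
        (subst (_ ℚ.<_) bxδy≡
          (∣*∣< {seq x m} {seq y m ℚ.- seq y n} δy (x<bx m (upperˡ (upperˡ ≤m)))
            (hy m n (upperʳ {Mx} (upperʳ {Nx ℕ.⊔ Ny} ≤m)) (upperʳ {Mx} (upperʳ {Nx ℕ.⊔ Ny} ≤n)))))
        (subst (_ ℚ.<_) byδx≡
          (∣*∣< {seq y n} {seq x m ℚ.- seq x n} δx (y<by n (upperʳ {Nx} (upperˡ ≤n)))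
            (hx m n (upperˡ (upperʳ {Nx ℕ.⊔ Ny} ≤m)) (upperˡ (upperʳ {Nx ℕ.⊔ Ny} ≤n))))))
  where
  open +-*-Solver
  regroup : ∀ p p′ q q′ → p ℚ.* (q ℚ.- q′) ℚ.+ q′ ℚ.* (p ℚ.- p′) ≡ p ℚ.* q ℚ.- p′ ℚ.* q′
  regroup = solve 4 (λ p p′ q q′ → p :* (q :- q′) :+ q′ :* (p :- p′) := p :* q :- p′ :* q′) refl

sumℝ : List ℝ → ℝ
sumℝ = List.foldr _+_ 0ℝ

indicator : ∀ {a} {A : Set a} → Dec A → ℝ
indicator A? = if does A? then 1ℝ else 0ℝ

-- A Heyting field whose apartness is inequality is a field in the usual
-- sense: x - y is invertible exactly when x ≢ y.

record FiniteField (q : ℕ) : Set₁ where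
  infixl 6 _+F_
  infixl 7 _*F_
  field
    F              : Set
    _+F_ _*F_      : Op₂ F
    -F_            : Op₁ F
    0F 1F          : F
    isHeytingField : IsHeytingField _≡_ _≢_ _+F_ _*F_ -F_ 0F 1F
    enumeration    : F ↔ Fin q

  open IsHeytingField isHeytingField public
    using (isCommutativeRing; #⇒invertible)

  commutativeRing : CommutativeRing 0ℓ 0ℓ
  commutativeRing = record { isCommutativeRing = isCommutativeRing }

  infix 4 _≟F_
  _≟F_ : DecidableEquality F
  _≟F_ = via-injection (↔⇒↣ enumeration) Fin._≟_

  elements : List F
  elements = List.map (Inverse.from enumeration) (List.allFin q)

  ∈-elements : ∀ x → x ∈ elements
  ∈-elements x = subst (_∈ elements) (Inverse.strictlyInverseʳ enumeration x)
    (∈-map⁺ _ (∈-allFin (Inverse.to enumeration x)))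

  ∀F? : ∀ {ℓ} {P : Pred F ℓ} → Decidable P → Dec (∀ x → P x)
  ∀F? {P = P} P? = map′
    (λ h x → subst P (Inverse.strictlyInverseʳ enumeration x) (h _))
    (λ h i → h _)
    (Fin.all? (P? ∘ Inverse.from enumeration))

  ∃F? : ∀ {ℓ} {P : Pred F ℓ} → Decidable P → Dec (∃ P)
  ∃F? {P = P} P? = map′
    (λ (i , h) → _ , h)
    (λ (x , h) → _ , subst P (sym (Inverse.strictlyInverseʳ enumeration x)) h)
    (Fin.any? (P? ∘ Inverse.from enumeration))

module _ {q : ℕ} (𝔽 : FiniteField q) where

  open FiniteField 𝔽

  infixl 6 _+ᵛ_
  infixr 7 _*ᵛ_

  _+ᵛ_ : ∀ {n} → Vec F n → Vec F n → Vec F n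
  _+ᵛ_ = Vec.zipWith _+F_

  _*ᵛ_ : ∀ {n} → F → Vec F n → Vec F n
  a *ᵛ v = Vec.map (a *F_) v

  0ᵛ : ∀ {n} → Vec F n
  0ᵛ = Vec.replicate _ 0F

  ⟨_,_⟩ : ∀ {n} → Vec F n → Vec F n → F
  ⟨ u , v ⟩ = Vec.foldr′ _+F_ 0F (Vec.zipWith _*F_ u v)

  combination : ∀ {n k} → Vec F k → Vec (Vec F n) k → Vec F n
  combination c vs = Vec.foldr′ _+ᵛ_ 0ᵛ (Vec.zipWith _*ᵛ_ c vs)

  record Subspace (n : ℕ) : Set₁ where
    field
      member   : Pred (Vec F n) 0ℓ
      0-closed : member 0ᵛ
      +-closed : ∀ {u v} → member u → member v → member (u +ᵛ v)
      *-closed : ∀ a {v} → member v → member (a *ᵛ v)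

  open Subspace public

  record IsBasis {n k} (U : Subspace n) (vs : Vec (Vec F n) k) : Set where
    field
      inside      : All (member U) vs
      independent : ∀ c → combination c vs ≡ 0ᵛ → c ≡ 0ᵛ
      spanning    : ∀ v → member U v → ∃ λ c → combination c vs ≡ v

  open IsBasis public

  record J (n k : ℕ) : Set₁ where
    field
      space   : Subspace n
      basis   : Vec (Vec F n) k
      isBasis : IsBasis space basis

  open J public

  Point : ℕ → Set₁
  Point n = J n 1

  infix 4 _∈ᴶ_ _⊆_ _⊥_ _≐_

  _∈ᴶ_ : ∀ {n k} → Vec F n → J n k → Set
  v ∈ᴶ V = member (space V) v

  _⊆_ : ∀ {n j k} → J n j → J n k → Set
  U ⊆ V = ∀ v → v ∈ᴶ U → v ∈ᴶ V

  _⊥_ : ∀ {n j k} → J n j → J n k → Set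
  U ⊥ V = ∀ u v → u ∈ᴶ U → v ∈ᴶ V → ⟨ u , v ⟩ ≡ 0F

  -- Equality of subspaces as sets of vectors; the chosen basis is irrelevant.
  _≐_ : ∀ {n k} → J n k → J n k → Set
  U ≐ V = U ⊆ V × V ⊆ U

  J-setoid : ℕ → ℕ → Setoid (Level.suc 0ℓ) 0ℓ
  J-setoid n k = record
    { Carrier       = J n k
    ; _≈_           = _≐_
    ; isEquivalence = record
      { refl  = (λ _ h → h) , (λ _ h → h)
      ; sym   = λ (p , q) → q , p
      ; trans = λ (p , q) (p′ , q′) → (λ v → p′ v ∘ p v) , (λ v → q v ∘ q′ v)
      }
    }

  infix 4 _≟ᵛ_
  _≟ᵛ_ : ∀ {n} → DecidableEquality (Vec F n)
  _≟ᵛ_ = Vec.≡-dec _≟F_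

  ∀Vec? : ∀ {ℓ n} {P : Pred (Vec F n) ℓ} → Decidable P → Dec (∀ v → P v)
  ∀Vec? {n = zero}  P? = map′ (λ { h [] → h }) (λ h → h []) (P? [])
  ∀Vec? {n = suc n} P? = map′ (λ { h (x ∷ v) → h x v }) (λ h x v → h (x ∷ v))
    (∀F? λ x → ∀Vec? λ v → P? (x ∷ v))

  ∃Vec? : ∀ {ℓ n} {P : Pred (Vec F n) ℓ} → Decidable P → Dec (∃ P)
  ∃Vec? {n = zero}  P? = map′ ([] ,_) (λ { ([] , h) → h }) (P? [])
  ∃Vec? {n = suc n} P? = map′ (λ (x , v , h) → x ∷ v , h) (λ { (x ∷ v , h) → x , v , h })
    (∃F? λ x → ∃Vec? λ v → P? (x ∷ v))

  combination-closed : ∀ {n k} (U : Subspace n) {vs : Vec (Vec F n) k} →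
                       All (member U) vs → ∀ c → member U (combination c vs)
  combination-closed U []       []      = 0-closed U
  combination-closed U (h ∷ hs) (a ∷ c) =
    +-closed U (*-closed U a h) (combination-closed U hs c)

  _∈ᴶ?_ : ∀ {n k} (v : Vec F n) (V : J n k) → Dec (v ∈ᴶ V)
  v ∈ᴶ? V = map′
    (λ (c , h) → subst (_∈ᴶ V) h (combination-closed (space V) (inside (isBasis V)) c))
    (spanning (isBasis V) v)
    (∃Vec? λ c → combination c (basis V) ≟ᵛ v)

  _⊆?_ : ∀ {n j k} (U : J n j) (V : J n k) → Dec (U ⊆ V)
  U ⊆? V = ∀Vec? λ v → (v ∈ᴶ? U) →-dec (v ∈ᴶ? V)

  _⊥?_ : ∀ {n j k} (U : J n j) (V : J n k) → Dec (U ⊥ V)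
  U ⊥? V = ∀Vec? λ u → ∀Vec? λ v →
    (u ∈ᴶ? U) →-dec ((v ∈ᴶ? V) →-dec (⟨ u , v ⟩ ≟F 0F))

  J-decSetoid : ℕ → ℕ → DecSetoid (Level.suc 0ℓ) 0ℓ
  J-decSetoid n k = record
    { Carrier          = J n k
    ; _≈_              = _≐_
    ; isDecEquivalence = record
      { isEquivalence = Setoid.isEquivalence (J-setoid n k)
      ; _≟_           = λ U V → (U ⊆? V) ×-dec (V ⊆? U)
      }
    }

  private
    module R = CommutativeRing commutativeRing
    module RP = RingProperties R.ring

  vectors : ∀ n → List (Vec F n)
  vectors zero    = [] ∷ []
  vectors (suc n) = List.cartesianProductWith _∷_ elements (vectors n)

  ∈-vectors : ∀ {n} (v : Vec F n) → v ∈ vectors n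
  ∈-vectors []      = here refl
  ∈-vectors (x ∷ v) = ∈-cartesianProductWith⁺ _∷_ (∈-elements x) (∈-vectors v)

  private
    *ᵛ-assoc : ∀ {n} a b (v : Vec F n) → a *ᵛ b *ᵛ v ≡ (a *F b) *ᵛ v
    *ᵛ-assoc a b []      = refl
    *ᵛ-assoc a b (x ∷ v) = cong₂ _∷_ (sym (R.*-assoc a b x)) (*ᵛ-assoc a b v)

    *ᵛ-distrib : ∀ {n} a b (v : Vec F n) → (a +F b) *ᵛ v ≡ a *ᵛ v +ᵛ b *ᵛ v
    *ᵛ-distrib a b []      = refl
    *ᵛ-distrib a b (x ∷ v) = cong₂ _∷_ (R.distribʳ x a b) (*ᵛ-distrib a b v)

    1*ᵛ : ∀ {n} (v : Vec F n) → 1F *ᵛ v ≡ v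
    1*ᵛ []      = refl
    1*ᵛ (x ∷ v) = cong₂ _∷_ (R.*-identityˡ x) (1*ᵛ v)

    0*ᵛ : ∀ {n} (v : Vec F n) → 0F *ᵛ v ≡ 0ᵛ
    0*ᵛ []      = refl
    0*ᵛ (x ∷ v) = cong₂ _∷_ (R.zeroˡ x) (0*ᵛ v)

    *0ᵛ : ∀ n a → a *ᵛ 0ᵛ {n} ≡ 0ᵛ
    *0ᵛ zero    a = refl
    *0ᵛ (suc n) a = cong₂ _∷_ (R.zeroʳ a) (*0ᵛ n a)

    +0ᵛ : ∀ {n} (v : Vec F n) → v +ᵛ 0ᵛ ≡ v
    +0ᵛ []      = refl
    +0ᵛ (x ∷ v) = cong₂ _∷_ (R.+-identityʳ x) (+0ᵛ v)

    *ᵛ-cancel : ∀ {n} a (v : Vec F n) → v ≢ 0ᵛ → a *ᵛ v ≡ 0ᵛ → a ≡ 0F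
    *ᵛ-cancel {n} a v v≢0 av≡0 with a ≟F 0F
    ... | yes a≡0 = a≡0
    ... | no  a≢0 = contradiction v≡0 v≢0
      where
      inverse = #⇒invertible a≢0
      b = proj₁ inverse
      ba≡1 : b *F a ≡ 1F
      ba≡1 = trans (cong (b *F_) (sym (trans (cong (a +F_) RP.-0#≈0#) (R.+-identityʳ a))))
               (proj₁ (proj₂ inverse))
      v≡0 : v ≡ 0ᵛ
      v≡0 = trans (sym (1*ᵛ v)) (trans (cong (_*ᵛ v) (sym ba≡1))
        (trans (sym (*ᵛ-assoc b a v)) (trans (cong (b *ᵛ_) av≡0) (*0ᵛ n b))))

  line : ∀ {n} (v : Vec F n) → v ≢ 0ᵛ → Point n
  line {n} v v≢0 = record
    { space   = record
      { member   = λ w → ∃ λ a → a *ᵛ v ≡ w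
      ; 0-closed = 0F , 0*ᵛ v
      ; +-closed = λ { (a , refl) (b , refl) → a +F b , *ᵛ-distrib a b v }
      ; *-closed = λ { a (b , refl) → a *F b , sym (*ᵛ-assoc a b v) }
      }
    ; basis   = v ∷ []
    ; isBasis = record
      { inside      = (1F , 1*ᵛ v) ∷ []
      ; independent = λ { (a ∷ []) h →
          cong (_∷ []) (*ᵛ-cancel a v v≢0 (trans (sym (+0ᵛ _)) h)) }
      ; spanning    = λ { _ (a , refl) → a ∷ [] , +0ᵛ _ }
      }
    }

  lines : ∀ {n} → List (Vec F n) → List (Point n)
  lines []       = []
  lines (v ∷ vs) with v ≟ᵛ 0ᵛ
  ... | yes _   = lines vs
  ... | no  v≢0 = line v v≢0 ∷ lines vs

  -- Every point exactly once: distinct nonzero vectors may span the same line.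
  points : ∀ n → List (Point n)
  points n = List.deduplicate (DecSetoid._≟_ (J-decSetoid n 1)) (lines (vectors n))

  points-unique : ∀ n → UniqueSetoid.Unique (J-setoid n 1) (points n)
  points-unique n = UniqueDec.deduplicate-! (J-decSetoid n 1) (lines (vectors n))

  points-complete : ∀ n → IsEnumeration (J-setoid n 1) (points n)
  points-complete n = Enumerates.deduplicate⁺ (J-decSetoid n 1) complete
    where
    open SetoidMembership (J-setoid n 1) using () renaming (_∈_ to _∈ₚ_)

    find : ∀ (p : Point n) v → v ≢ 0ᵛ → (∀ v≢0 → p ≐ line v v≢0) →
           ∀ {vs} → v ∈ vs → p ∈ₚ lines vs
    find p v v≢0 h {w ∷ vs} (here refl) with v ≟ᵛ 0ᵛ
    ... | yes v≡0 = contradiction v≡0 v≢0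
    ... | no  v≢0 = here (h v≢0)
    find p v v≢0 h {w ∷ vs} (there i) with w ≟ᵛ 0ᵛ
    ... | yes _ = find p v v≢0 h i
    ... | no  _ = there (find p v v≢0 h i)

    complete : IsEnumeration (J-setoid n 1) (lines (vectors n))
    complete p with basis p | isBasis p
    ... | v ∷ [] | record { inside = v∈p ∷ [] ; independent = ind ; spanning = span } =
      find p v v≢0
        (λ _ → (λ w w∈p → case-span (span w w∈p))
             , (λ { w (a , refl) → *-closed (space p) a v∈p }))
        (∈-vectors v)
      where
      v≢0 : v ≢ 0ᵛ
      v≢0 refl = 1≢0 (cong Vec.head (ind (1F ∷ []) (trans (+0ᵛ _) (1*ᵛ _))))
        where
        1≢0 : 1F ≢ 0F
        1≢0 1≡0 = IsHeytingField.invertible⇒# isHeytingField {0F} {0F}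
          (1F , trivial _ _ , trivial _ _) refl
          where
          trivial : ∀ x y → x ≡ y
          trivial x y = trans (collapse x) (sym (collapse y))
            where
            collapse : ∀ z → z ≡ 0F
            collapse z = trans (sym (R.*-identityˡ z)) (trans (cong (_*F z) 1≡0) (R.zeroˡ z))
      case-span : ∀ {w} → (∃ λ c → combination c (v ∷ []) ≡ w) → ∃ λ a → a *ᵛ v ≡ w
      case-span (a ∷ [] , h) = a , trans (sym (+0ᵛ _)) h

  -- Functions on J n k respect equality of subspaces.
  JFunction : ℕ → ℕ → Set₁
  JFunction n k = Func (J-setoid n k) ℝ-setoid

  data TrivialForm (n : ℕ) : Set₁ where
    zero one   : TrivialForm n
    x 1-x      : (p : Point n) → TrivialForm n
    y 1-y      : (r : Point n) → TrivialForm n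
    x+y 1-x-y  : (p r : Point n) → ¬ p ⊥ r → TrivialForm n

  module _ {n k : ℕ} where

    open Func using (to)

    𝐱 : Point n → J n k → ℝ
    𝐱 p V = indicator (p ⊆? V)

    𝐲 : Point n → J n k → ℝ
    𝐲 r V = indicator (V ⊥? r)

    Boolean : JFunction n k → Set₁
    Boolean f = ∀ V → to f V ≈ 0ℝ ⊎ to f V ≈ 1ℝ

    DegreeOne : JFunction n k → Set₁
    DegreeOne f = Σ (JFunction n 1) λ c →
      ∀ V → to f V ≈ sumℝ (List.map (λ p → to c p * 𝐱 p V) (points n))

    ⟦_⟧ : TrivialForm n → J n k → ℝ
    ⟦ zero        ⟧ V = 0ℝ
    ⟦ one         ⟧ V = 1ℝ
    ⟦ x p         ⟧ V = 𝐱 p V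
    ⟦ 1-x p       ⟧ V = 1ℝ - 𝐱 p V
    ⟦ y r         ⟧ V = 𝐲 r V
    ⟦ 1-y r       ⟧ V = 1ℝ - 𝐲 r V
    ⟦ x+y p r _   ⟧ V = 𝐱 p V + 𝐲 r V
    ⟦ 1-x-y p r _ ⟧ V = 1ℝ - 𝐱 p V - 𝐲 r V

    Trivial : JFunction n k → Set₁
    Trivial f = Σ (TrivialForm n) λ t → ∀ V → to f V ≈ ⟦ t ⟧ V

  DOT : ℕ → ℕ → Set₁
  DOT n k = ∀ (f : JFunction n k) → Boolean f → DegreeOne f → Trivial f

{-# OPTIONS --safe #-}
module Submission where

-- It suffices to go from F^m to F^n with n = m + 1, where n is at least k + 3. Let f
-- be a Boolean degree one function on the k-spaces of F^n. A hyperplane, the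
-- orthogonal complement of a vector h, is isomorphic to F^m, and f restricted to the k-spaces inside it is
-- again Boolean of degree one: a point outside a subspace contributes nothing, so the
-- sum over all points reduces to the sum over the points of the hyperplane
-- (restrict-degreeOne). Hence the restriction is a trivial form, which is described
-- by a sign e, an optional point p and an optional second vector s, the slope: the
-- value is 1 - e on the k-spaces which contain p or are orthogonal to s, and e on the
-- others (On, local). From here on only the resulting 0/1 function matters, and the
-- task is to glue the local descriptions to a global one (glue).
--
-- Two hyperplanes are compared on their intersection M, using three test-space
-- lemmas: at most k vectors orthogonal to at most three given ones lie in a k-space
-- orthogonal to these three (extend); a vector outside a span is detected by an
-- orthogonal vector (separate); and there are vectors orthogonal to given ones
-- outside a given small span (avoid).
--
-- If no hyperplane has a slope, all signs agree (compare-flat). Otherwise fix h0 with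
-- slope s0. For h outside the span of h0 and s0, the vector s0 does not vanish on M,
-- and testing with k-spaces in M which are orthogonal to s0, and with k-spaces in M
-- which contain a prescribed vector orthogonal to s0 but avoid a prescribed point and
-- are not orthogonal to s0 (escape), shows that h has the same sign as h0 and that
-- its slope lies in the span of h, h0 and s0 (Compare). Modulo h the slope is
-- therefore a vector r in the span of h0 and s0. Comparing two such hyperplanes in
-- general position shows that r does not depend on h up to a scalar (slope-unique),
-- and an auxiliary third hyperplane removes the assumption of general position. So r
-- is a common slope for all hyperplanes h outside a two-dimensional span, and these
-- hyperplanes suffice, since every k-space is orthogonal to some h outside that span.
--
-- Finally, when sign and slope are common, the point of one hyperplane is also the
-- point of every other hyperplane through it (same-point), and any two points are
-- compared on a hyperplane through both of them, so all points coincide (assemble).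

open import Defs hiding (x; y)
import Defs
open import Data.Nat.Base using (ℕ; zero; suc; _≤_; _<_; s≤s; z≤n; _^_) renaming (_+_ to _+ℕ_)
open import Algebra.Apartness.Structures using (IsHeytingField)
open import Algebra.Bundles using (CommutativeMonoid; CommutativeRing)
import Algebra.Properties.Ring as RingProperties
import Algebra.Solver.Ring.NaturalCoefficients.Default as RingSolver
open import Data.Bool.Base using (Bool; true; false; not; _∨_)
import Data.Bool.Properties as Bool
open import Data.Empty using (⊥; ⊥-elim)
open import Data.Fin.Base as Fin using (Fin; combine; remQuot)
import Data.Fin.Properties as Fin
open import Data.List.Base as List using (List; []; _∷_)
import Data.List.Membership.Setoid as SetoidMembership
import Data.List.Membership.Setoid.Properties as Membership
import Data.List.Properties as List
open import Data.List.Relation.Unary.All as ListAll using ([]; _∷_)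
open import Data.List.Relation.Unary.AllPairs using ([]; _∷_)
open import Data.List.Relation.Unary.Any using (here; there)
import Data.List.Relation.Unary.Unique.Setoid as UniqueSetoid
import Data.List.Relation.Unary.Unique.Setoid.Properties as Unique
open import Data.Maybe.Base as Maybe using (Maybe; just; nothing)
open import Data.Maybe.Properties using (just-injective)
import Data.Nat.Base as ℕ
import Data.Nat.Properties as ℕ
open import Data.Product.Base using (∃; ∃₂; _×_; _,_; proj₁; proj₂)
open import Data.Rational.Base as ℚ using (1ℚ; ½)
import Data.Rational.Properties as ℚ
open import Data.Rational.Solver using (module +-*-Solver)
open import Data.Sum.Base using (_⊎_; inj₁; inj₂; [_,_]′)
open import Data.Vec.Base as Vec using (Vec; []; _∷_; _++_)
import Data.Vec.Properties as Vec
open import Data.Vec.Relation.Unary.All as All using (All; []; _∷_)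
import Data.Vec.Relation.Unary.All.Properties as All
open import Function.Base using (_∘_; id)
open import Function.Bundles using (Func; module Inverse)
open import Level as Level using (0ℓ)
open import Relation.Binary.Bundles using (Setoid)
open import Relation.Binary.PropositionalEquality
  using (_≡_; _≢_; refl; sym; trans; cong; cong₂; subst; module ≡-Reasoning)
open import Relation.Nullary using (¬_; Dec; yes; no; contradiction)
open import Relation.Nullary.Decidable using (¬?; _×-dec_; _⊎-dec_; _→-dec_; decidable-stable)

-- Linear algebra over a finite field

module LinearAlgebra {q : ℕ} (𝔽 : FiniteField q) where

  open FiniteField 𝔽
  module R = CommutativeRing commutativeRing
  module RP = RingProperties R.ring
  open RingSolver R.commutativeSemiring using (solve; _:+_; _:*_; _:=_)

  1≢0 : 1F ≢ 0F
  1≢0 1≡0 = IsHeytingField.invertible⇒# isHeytingField {0F} {0F}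
    (1F , all-equal _ _ , all-equal _ _) refl
    where
    all-zero : ∀ z → z ≡ 0F
    all-zero z = trans (sym (R.*-identityˡ z)) (trans (cong (_*F z) 1≡0) (R.zeroˡ z))
    all-equal : ∀ y z → y ≡ z
    all-equal y z = trans (all-zero y) (sym (all-zero z))

  inverse : ∀ {a} → a ≢ 0F → ∃ λ b → b *F a ≡ 1F
  inverse {a} a≢0 = let b , ba≡1 , _ = #⇒invertible a≢0 in
    b , trans (cong (b *F_) (sym (trans (cong (a +F_) RP.-0#≈0#) (R.+-identityʳ a)))) ba≡1

  -- Vectors and the standard bilinear form

  𝕍 : ℕ → Set
  𝕍 n = Vec F n

  infixl 6 _⊕_
  infixr 7 _·_

  _⊕_ : ∀ {n} → 𝕍 n → 𝕍 n → 𝕍 n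
  _⊕_ = _+ᵛ_ 𝔽

  _·_ : ∀ {n} → F → 𝕍 n → 𝕍 n
  _·_ = _*ᵛ_ 𝔽

  𝟎 : ∀ {n} → 𝕍 n
  𝟎 = 0ᵛ 𝔽

  abstract
    -- The standard bilinear form; it is used through its bilinearity only.
    ⟪_,_⟫ : ∀ {n} → 𝕍 n → 𝕍 n → F
    ⟪_,_⟫ = ⟨_,_⟩ 𝔽

    ⟪⟫-def : ∀ {n} (u v : 𝕍 n) → ⟪ u , v ⟫ ≡ ⟨_,_⟩ 𝔽 u v
    ⟪⟫-def u v = refl

    ⟪⟫-∷ : ∀ {n} a b (u v : 𝕍 n) → ⟪ a ∷ u , b ∷ v ⟫ ≡ a *F b +F ⟪ u , v ⟫
    ⟪⟫-∷ a b u v = refl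

  ⊕-assoc : ∀ {n} (u v w : 𝕍 n) → (u ⊕ v) ⊕ w ≡ u ⊕ (v ⊕ w)
  ⊕-assoc = Vec.zipWith-assoc R.+-assoc

  ⊕-comm : ∀ {n} (u v : 𝕍 n) → u ⊕ v ≡ v ⊕ u
  ⊕-comm = Vec.zipWith-comm R.+-comm

  ⊕-identityˡ : ∀ {n} (v : 𝕍 n) → 𝟎 ⊕ v ≡ v
  ⊕-identityˡ = Vec.zipWith-identityˡ R.+-identityˡ

  ⊕-identityʳ : ∀ {n} (v : 𝕍 n) → v ⊕ 𝟎 ≡ v
  ⊕-identityʳ = Vec.zipWith-identityʳ R.+-identityʳ

  ·-assoc : ∀ {n} a b (v : 𝕍 n) → a · b · v ≡ (a *F b) · v
  ·-assoc a b []      = refl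
  ·-assoc a b (x ∷ v) = cong₂ _∷_ (sym (R.*-assoc a b x)) (·-assoc a b v)

  ·-distribʳ : ∀ {n} a b (v : 𝕍 n) → (a +F b) · v ≡ a · v ⊕ b · v
  ·-distribʳ a b []      = refl
  ·-distribʳ a b (x ∷ v) = cong₂ _∷_ (R.distribʳ x a b) (·-distribʳ a b v)

  ·-distribˡ : ∀ {n} a (u v : 𝕍 n) → a · (u ⊕ v) ≡ a · u ⊕ a · v
  ·-distribˡ a []      []      = refl
  ·-distribˡ a (x ∷ u) (y ∷ v) = cong₂ _∷_ (R.distribˡ a x y) (·-distribˡ a u v)

  1· : ∀ {n} (v : 𝕍 n) → 1F · v ≡ v
  1· []      = refl
  1· (x ∷ v) = cong₂ _∷_ (R.*-identityˡ x) (1· v)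

  0· : ∀ {n} (v : 𝕍 n) → 0F · v ≡ 𝟎
  0· []      = refl
  0· (x ∷ v) = cong₂ _∷_ (R.zeroˡ x) (0· v)

  ·𝟎 : ∀ {n} a → a · 𝟎 {n} ≡ 𝟎
  ·𝟎 {zero}  a = refl
  ·𝟎 {suc n} a = cong₂ _∷_ (R.zeroʳ a) (·𝟎 a)

  ·-cancel : ∀ {n} a (v : 𝕍 n) → a · v ⊕ (-F a) · v ≡ 𝟎
  ·-cancel a v = trans (sym (·-distribʳ a (-F a) v))
    (trans (cong (_· v) (R.-‿inverseʳ a)) (0· v))

  ⊕-undo : ∀ {n} (u : 𝕍 n) a v → (a · v ⊕ u) ⊕ (-F a) · v ≡ u
  ⊕-undo u a v = begin
    (a · v ⊕ u) ⊕ (-F a) · v  ≡⟨ cong (_⊕ (-F a) · v) (⊕-comm (a · v) u) ⟩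
    (u ⊕ a · v) ⊕ (-F a) · v  ≡⟨ ⊕-assoc u _ _ ⟩
    u ⊕ (a · v ⊕ (-F a) · v)  ≡⟨ cong (u ⊕_) (·-cancel a v) ⟩
    u ⊕ 𝟎                     ≡⟨ ⊕-identityʳ u ⟩
    u                         ∎
    where open ≡-Reasoning

  ⊕-redo : ∀ {n} (u : 𝕍 n) a v → a · v ⊕ (u ⊕ (-F a) · v) ≡ u
  ⊕-redo u a v = begin
    a · v ⊕ (u ⊕ (-F a) · v)  ≡⟨ sym (⊕-assoc _ u _) ⟩
    (a · v ⊕ u) ⊕ (-F a) · v  ≡⟨ ⊕-undo u a v ⟩
    u                         ∎
    where open ≡-Reasoning

  abstract
    ⟪⟫-comm : ∀ {n} (u v : 𝕍 n) → ⟪ u , v ⟫ ≡ ⟪ v , u ⟫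
    ⟪⟫-comm []      []      = refl
    ⟪⟫-comm (x ∷ u) (y ∷ v) = cong₂ _+F_ (R.*-comm x y) (⟪⟫-comm u v)

  abstract
    ⟪⟫-⊕ʳ : ∀ {n} (t u v : 𝕍 n) → ⟪ t , u ⊕ v ⟫ ≡ ⟪ t , u ⟫ +F ⟪ t , v ⟫
    ⟪⟫-⊕ʳ []      []      []      = sym (R.+-identityˡ 0F)
    ⟪⟫-⊕ʳ (z ∷ t) (x ∷ u) (y ∷ v) = trans (cong (_ +F_) (⟪⟫-⊕ʳ t u v))
      (solve 5 (λ z x y a b → z :* (x :+ y) :+ (a :+ b) := (z :* x :+ a) :+ (z :* y :+ b))
        refl z x y _ _)

  abstract
    ⟪⟫-·ʳ : ∀ {n} (t : 𝕍 n) a v → ⟪ t , a · v ⟫ ≡ a *F ⟪ t , v ⟫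
    ⟪⟫-·ʳ []      a []      = sym (R.zeroʳ a)
    ⟪⟫-·ʳ (z ∷ t) a (y ∷ v) = trans (cong (_ +F_) (⟪⟫-·ʳ t a v))
      (solve 4 (λ z y a b → z :* (a :* y) :+ a :* b := a :* (z :* y :+ b)) refl z y a _)

  ⟪⟫-⊕ˡ : ∀ {n} (u v t : 𝕍 n) → ⟪ u ⊕ v , t ⟫ ≡ ⟪ u , t ⟫ +F ⟪ v , t ⟫
  ⟪⟫-⊕ˡ u v t = trans (⟪⟫-comm _ t) (trans (⟪⟫-⊕ʳ t u v)
    (cong₂ _+F_ (⟪⟫-comm t u) (⟪⟫-comm t v)))

  ⟪⟫-·ˡ : ∀ {n} a (v t : 𝕍 n) → ⟪ a · v , t ⟫ ≡ a *F ⟪ v , t ⟫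
  ⟪⟫-·ˡ a v t = trans (⟪⟫-comm _ t) (trans (⟪⟫-·ʳ t a v) (cong (a *F_) (⟪⟫-comm t v)))

  ⟪⟫-𝟎ʳ : ∀ {n} (t : 𝕍 n) → ⟪ t , 𝟎 ⟫ ≡ 0F
  ⟪⟫-𝟎ʳ t = trans (cong ⟪ t ,_⟫ (sym (0· 𝟎))) (trans (⟪⟫-·ʳ t 0F 𝟎) (R.zeroˡ _))

  abstract
    nondegenerate : ∀ {n} (p : 𝕍 n) → p ≢ 𝟎 → ∃ λ t → ⟪ p , t ⟫ ≢ 0F
    nondegenerate []      p≢0 = contradiction refl p≢0
    nondegenerate (x ∷ p) p≢0 with x ≟F 0F
    ... | no  x≢0  = 1F ∷ 𝟎 , λ xp≡0 → x≢0 (trans (sym (begin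
      x *F 1F +F ⟪ p , 𝟎 ⟫  ≡⟨ cong₂ _+F_ (R.*-identityʳ x) (⟪⟫-𝟎ʳ p) ⟩
      x +F 0F               ≡⟨ R.+-identityʳ x ⟩
      x                     ∎)) xp≡0)
      where open ≡-Reasoning
    ... | yes refl = let t , pt≢0 = nondegenerate p (p≢0 ∘ cong (0F ∷_)) in
      0F ∷ t , pt≢0 ∘ trans (sym (trans (cong (_+F ⟪ p , t ⟫) (R.zeroˡ 0F)) (R.+-identityˡ _)))

  -- Spans and orthogonal complements

  -- The linear combination of vs with coefficients c.
  comb : ∀ {n k} → 𝕍 k → Vec (𝕍 n) k → 𝕍 n
  comb = combination 𝔽

  comb-⊕ : ∀ {n k} (c d : 𝕍 k) (vs : Vec (𝕍 n) k) → comb (c ⊕ d) vs ≡ comb c vs ⊕ comb d vs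
  comb-⊕ []      []      []       = sym (⊕-identityˡ 𝟎)
  comb-⊕ (a ∷ c) (b ∷ d) (v ∷ vs) = begin
    (a +F b) · v ⊕ comb (c ⊕ d) vs              ≡⟨ cong₂ _⊕_ (·-distribʳ a b v) (comb-⊕ c d vs) ⟩
    (a · v ⊕ b · v) ⊕ (comb c vs ⊕ comb d vs)   ≡⟨ interchange (a · v) (b · v) _ _ ⟩
    (a · v ⊕ comb c vs) ⊕ (b · v ⊕ comb d vs)   ∎
    where
    open ≡-Reasoning
    interchange : ∀ {n} (s t u v : 𝕍 n) → (s ⊕ t) ⊕ (u ⊕ v) ≡ (s ⊕ u) ⊕ (t ⊕ v)
    interchange []      []      []      []      = refl
    interchange (x ∷ s) (y ∷ t) (z ∷ u) (w ∷ v) = cong₂ _∷_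
      (solve 4 (λ x y z w → (x :+ y) :+ (z :+ w) := (x :+ z) :+ (y :+ w)) refl x y z w)
      (interchange s t u v)

  comb-· : ∀ {n k} a (c : 𝕍 k) (vs : Vec (𝕍 n) k) → comb (a · c) vs ≡ a · comb c vs
  comb-· a []      []       = sym (·𝟎 a)
  comb-· a (b ∷ c) (v ∷ vs) = trans (cong₂ _⊕_ (sym (·-assoc a b v)) (comb-· a c vs))
    (sym (·-distribˡ a _ _))

  comb-𝟎 : ∀ {n k} (vs : Vec (𝕍 n) k) → comb 𝟎 vs ≡ 𝟎
  comb-𝟎 vs = trans (cong (λ c → comb c vs) (sym (0· 𝟎))) (trans (comb-· 0F 𝟎 vs) (0· _))

  -- The subspace of all linear combinations.
  span : ∀ {n k} → Vec (𝕍 n) k → Subspace 𝔽 n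
  span vs = record
    { member   = λ x → ∃ λ c → comb c vs ≡ x
    ; 0-closed = 𝟎 , comb-𝟎 vs
    ; +-closed = λ { (c , refl) (d , refl) → c ⊕ d , comb-⊕ c d vs }
    ; *-closed = λ { a (c , refl) → a · c , comb-· a c vs }
    }

  infix 4 _∈_ _∈span_ _∈perp_ _∈span?_

  _∈_ : ∀ {n} → 𝕍 n → Subspace 𝔽 n → Set
  v ∈ U = member U v

  _∈span_ : ∀ {n k} → 𝕍 n → Vec (𝕍 n) k → Set
  v ∈span vs = v ∈ span vs

  _∈span?_ : ∀ {n k} (v : 𝕍 n) (vs : Vec (𝕍 n) k) → Dec (v ∈span vs)
  v ∈span? vs = ∃Vec? 𝔽 λ c → _≟ᵛ_ 𝔽 (comb c vs) v

  span-least : ∀ {n k} (U : Subspace 𝔽 n) {vs : Vec (𝕍 n) k} →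
               All (_∈ U) vs → ∀ {v} → v ∈span vs → v ∈ U
  span-least U vs⊆U (c , refl) = combination-closed 𝔽 U vs⊆U c

  span-head : ∀ {n k} {v : 𝕍 n} {vs : Vec (𝕍 n) k} → v ∈span v ∷ vs
  span-head {v = v} {vs} = 1F ∷ 𝟎 , trans (cong₂ _⊕_ (1· v) (comb-𝟎 vs)) (⊕-identityʳ v)

  span-tail : ∀ {n k} {u v : 𝕍 n} {vs : Vec (𝕍 n) k} → u ∈span vs → u ∈span v ∷ vs
  span-tail {v = v} (c , refl) = 0F ∷ c , trans (cong (_⊕ _) (0· v)) (⊕-identityˡ _)

  generators : ∀ {n k} (vs : Vec (𝕍 n) k) → All (_∈span vs) vs
  generators []       = []
  generators (v ∷ vs) = span-head ∷ All.map span-tail (generators vs)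

  -- The equation x = a v + r with b a = 1 is solved by v = b x - b r.
  solve-head : ∀ {n} a b (v r : 𝕍 n) → b *F a ≡ 1F → b · (a · v ⊕ r) ⊕ (-F b) · r ≡ v
  solve-head a b v r ba≡1 = begin
    b · (a · v ⊕ r) ⊕ (-F b) · r      ≡⟨ cong (_⊕ (-F b) · r) (·-distribˡ b _ r) ⟩
    (b · a · v ⊕ b · r) ⊕ (-F b) · r  ≡⟨ ⊕-assoc _ _ _ ⟩
    b · a · v ⊕ (b · r ⊕ (-F b) · r)  ≡⟨ cong₂ _⊕_ (·-assoc b a v) (·-cancel b r) ⟩
    (b *F a) · v ⊕ 𝟎                  ≡⟨ ⊕-identityʳ _ ⟩
    (b *F a) · v                      ≡⟨ cong (_· v) ba≡1 ⟩
    1F · v                            ≡⟨ 1· v ⟩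
    v                                 ∎
    where open ≡-Reasoning

  -- The Steinitz exchange property.
  exchange : ∀ {n k} {x v : 𝕍 n} {vs : Vec (𝕍 n) k} →
             x ∈span v ∷ vs → ¬ x ∈span vs → v ∈span x ∷ vs
  exchange {x = x} {v} {vs} (a ∷ c , refl) x∉ with a ≟F 0F
  ... | yes refl = contradiction (c , sym (trans (cong (_⊕ _) (0· v)) (⊕-identityˡ _))) x∉
  ... | no  a≢0  = let b , ba≡1 = inverse a≢0 in
    b ∷ (-F b) · c , trans (cong (b · x ⊕_) (comb-· (-F b) c vs)) (solve-head a b v _ ba≡1)

  -- The subspace of the vectors orthogonal to each of hs.
  perp : ∀ {n k} → Vec (𝕍 n) k → Subspace 𝔽 n
  perp hs = record
    { member   = λ v → All (λ h → ⟪ h , v ⟫ ≡ 0F) hs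
    ; 0-closed = All.universal ⟪⟫-𝟎ʳ hs
    ; +-closed = λ {u} {v} hu hv → All.map
        (λ {h} (p , r) → trans (⟪⟫-⊕ʳ h u v) (trans (cong₂ _+F_ p r) (R.+-identityʳ 0F))) (All.zip (hu , hv))
    ; *-closed = λ a {v} hv → All.map
        (λ {h} p → trans (⟪⟫-·ʳ h a v) (trans (cong (a *F_) p) (R.zeroʳ a))) hv
    }

  _∈perp_ : ∀ {n k} → 𝕍 n → Vec (𝕍 n) k → Set
  v ∈perp hs = v ∈ perp hs

  perp-sym : ∀ {n} (u v : 𝕍 n) → ⟪ u , v ⟫ ≡ 0F → ⟪ v , u ⟫ ≡ 0F
  perp-sym u v = trans (⟪⟫-comm v u)

  -- A vector orthogonal to generators is orthogonal to their span.
  perp-span : ∀ {n k} {hs : Vec (𝕍 n) k} {h t} → t ∈perp hs → h ∈span hs → ⟪ h , t ⟫ ≡ 0F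
  perp-span {h = h} {t} t⊥hs h∈
    with span-least (perp (t ∷ [])) (All.map (λ {h} p → perp-sym h t p ∷ []) t⊥hs) h∈
  ... | p ∷ [] = perp-sym t h p

  abstract
    -- Double orthogonality: a vector orthogonal to everything that is orthogonal to vs
    -- lies in the span of vs. Induction on vs. If v is outside the span of vs, some t₀
    -- orthogonal to vs has ⟪ v , t₀ ⟫ ≢ 0; subtracting from p a multiple of v makes p
    -- orthogonal to t₀, and a vector found for the modified p is corrected by a multiple
    -- of t₀ so as to be orthogonal to v.
    separate : ∀ {n k} (vs : Vec (𝕍 n) k) p → p ∈span vs ⊎ (∃ λ t → t ∈perp vs × ⟪ p , t ⟫ ≢ 0F)
    separate []       p with _≟ᵛ_ 𝔽 p 𝟎
    ... | yes refl = inj₁ ([] , refl)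
    ... | no  p≢0  = let t , pt≢0 = nondegenerate p p≢0 in inj₂ (t , [] , pt≢0)
    separate (v ∷ vs) p with separate vs v
    separate (v ∷ vs) p | inj₁ v∈ with separate vs p
    ... | inj₁ p∈               = inj₁ (span-tail p∈)
    ... | inj₂ (t , t⊥ , pt≢0) = inj₂ (t , perp-span t⊥ v∈ ∷ t⊥ , pt≢0)
    separate {n} (v ∷ vs) p | inj₂ (t₀ , t₀⊥ , vt₀≢0) with inverse vt₀≢0
    ... | d , dv≡1 with separate vs (p ⊕ (-F (⟪ p , t₀ ⟫ *F d)) · v)
    ... | inj₁ (c , eq) = inj₁ (⟪ p , t₀ ⟫ *F d ∷ c ,
            trans (cong (_ ⊕_) eq) (⊕-redo p _ v))
    ... | inj₂ (t₁ , t₁⊥ , ≢0) = inj₂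
        ( t
        , trans (at v) (trans (cong (⟪ v , t₁ ⟫ +F_) (begin
            (-F (⟪ v , t₁ ⟫ *F d)) *F ⟪ v , t₀ ⟫   ≡⟨ sym (RP.-‿distribˡ-* _ _) ⟩
            -F (⟪ v , t₁ ⟫ *F d *F ⟪ v , t₀ ⟫)     ≡⟨ cong -F_ (R.*-assoc _ d _) ⟩
            -F (⟪ v , t₁ ⟫ *F (d *F ⟪ v , t₀ ⟫))   ≡⟨ cong (λ e → -F (_ *F e)) dv≡1 ⟩
            -F (⟪ v , t₁ ⟫ *F 1F)                  ≡⟨ cong -F_ (R.*-identityʳ _) ⟩
            -F ⟪ v , t₁ ⟫                          ∎)) (R.-‿inverseʳ _))
          ∷ +-closed (perp vs) t₁⊥ (*-closed (perp vs) _ t₀⊥)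
        , λ pt≡0 → ≢0 (trans (trans (⟪⟫-⊕ˡ p _ t₁) (trans (cong (⟪ p , t₁ ⟫ +F_)
            (trans (⟪⟫-·ˡ _ v t₁) swap)) (sym (at p)))) pt≡0))
      where
      open ≡-Reasoning
      t : 𝕍 n
      t = t₁ ⊕ (-F (⟪ v , t₁ ⟫ *F d)) · t₀
      at : ∀ w → ⟪ w , t ⟫ ≡ ⟪ w , t₁ ⟫ +F (-F (⟪ v , t₁ ⟫ *F d)) *F ⟪ w , t₀ ⟫
      at w = trans (⟪⟫-⊕ʳ w t₁ _) (cong (_ +F_) (⟪⟫-·ʳ w _ t₀))
      swap : (-F (⟪ p , t₀ ⟫ *F d)) *F ⟪ v , t₁ ⟫ ≡ (-F (⟪ v , t₁ ⟫ *F d)) *F ⟪ p , t₀ ⟫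
      swap = trans (sym (RP.-‿distribˡ-* _ _)) (trans (cong -F_
        (solve 3 (λ x d y → x :* d :* y := y :* d :* x) refl _ d _)) (RP.-‿distribˡ-* _ _))

  abstract
    separated : ∀ {n k} (vs : Vec (𝕍 n) k) {p} → ¬ p ∈span vs → ∃ λ t → t ∈perp vs × ⟪ p , t ⟫ ≢ 0F
    separated vs {p} p∉ = [ (λ p∈ → contradiction p∈ p∉) , id ]′ (separate vs p)

  swap₂ : ∀ {n} {a b v : 𝕍 n} → v ∈span a ∷ b ∷ [] → v ∈span b ∷ a ∷ []
  swap₂ {_} {a} {b} = span-least (span (b ∷ a ∷ [])) (span-tail span-head ∷ span-head ∷ [])

  ∈span[]⇒≡𝟎 : ∀ {n} {v : 𝕍 n} → v ∈span [] → v ≡ 𝟎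
  ∈span[]⇒≡𝟎 ([] , e) = sym e

  span-sym : ∀ {n} {u v : 𝕍 n} → u ≢ 𝟎 → u ∈span v ∷ [] → v ∈span u ∷ []
  span-sym u≢0 u∈ = exchange u∈ (u≢0 ∘ ∈span[]⇒≡𝟎)

  span-trans : ∀ {n} {u v w : 𝕍 n} → u ∈span v ∷ [] → v ∈span w ∷ [] → u ∈span w ∷ []
  span-trans {w = w} u∈ v∈ = span-least (span (w ∷ [])) (v∈ ∷ []) u∈

  first : ∀ {n ℓ} {Q : 𝕍 n → Set ℓ} {m a} {as : Vec (𝕍 n) m} → All Q (a ∷ as) → Q a
  first = All.head

  second : ∀ {n ℓ} {Q : 𝕍 n → Set ℓ} {m a b} {as : Vec (𝕍 n) m} → All Q (a ∷ b ∷ as) → Q b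
  second = All.head ∘ All.tail

  third : ∀ {n ℓ} {Q : 𝕍 n → Set ℓ} {m a b c} {as : Vec (𝕍 n) m} → All Q (a ∷ b ∷ c ∷ as) → Q c
  third = All.head ∘ All.tail ∘ All.tail

  -- Dimension by counting

  1<q : 1 < q
  1<q = go _ (Inverse.to enumeration) (Inverse.from enumeration) (Inverse.strictlyInverseʳ enumeration)
    where
    go : ∀ m (to : F → Fin m) (from : Fin m → F) → (∀ a → from (to a) ≡ a) → 1 < m
    go zero          to from _ = contradiction (to 0F) λ ()
    go (suc zero)    to from e = contradiction
      (trans (sym (e 1F)) (trans (cong from (only (to 1F) (to 0F))) (e 0F))) 1≢0
      where
      only : ∀ (i j : Fin 1) → i ≡ j
      only Fin.zero Fin.zero = refl
    go (suc (suc m)) to from _ = s≤s (s≤s z≤n)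

  -- The q-adic numbering of F^n.
  encode : ∀ {n} → 𝕍 n → Fin (q ^ n)
  encode []      = Fin.zero
  encode (x ∷ v) = combine (Inverse.to enumeration x) (encode v)

  encode-injective : ∀ {n} (u v : 𝕍 n) → encode u ≡ encode v → u ≡ v
  encode-injective []      []      _ = refl
  encode-injective (x ∷ u) (y ∷ v) e =
    let x≡y , u≡v = Fin.combine-injective (Inverse.to enumeration x) (encode u) _ (encode v) e
    in cong₂ _∷_
      (trans (sym (Inverse.strictlyInverseʳ enumeration x))
        (trans (cong (Inverse.from enumeration) x≡y) (Inverse.strictlyInverseʳ enumeration y)))
      (encode-injective u v u≡v)

  decode : ∀ n → Fin (q ^ n) → 𝕍 n
  decode zero    i = []
  decode (suc n) i = Inverse.from enumeration (proj₁ (remQuot (q ^ n) i)) ∷ decode n (proj₂ (remQuot {q} (q ^ n) i))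

  decode-injective : ∀ n (i j : Fin (q ^ n)) → decode n i ≡ decode n j → i ≡ j
  decode-injective zero    Fin.zero Fin.zero _ = refl
  decode-injective (suc n) i j e =
    trans (sym (Fin.combine-remQuot {q} (q ^ n) i)) (trans (cong₂ combine
      (trans (sym (Inverse.strictlyInverseˡ enumeration _))
        (trans (cong (Inverse.to enumeration) (Vec.∷-injectiveˡ e)) (Inverse.strictlyInverseˡ enumeration _)))
      (decode-injective n _ _ (Vec.∷-injectiveʳ e)))
      (Fin.combine-remQuot {q} (q ^ n) j))

  -- Comparing cardinalities: an injection of F^m into F^n forces m ≤ n.
  injection⇒≤ : ∀ {m n} (f : 𝕍 m → 𝕍 n) → (∀ u v → f u ≡ f v → u ≡ v) → m ≤ n
  injection⇒≤ {m} {n} f f-inj = ℕ.≮⇒≥ λ n<m →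
    ℕ.<⇒≱ (ℕ.^-monoʳ-< q 1<q n<m)
      (Fin.injective⇒≤ {f = encode ∘ f ∘ decode m} λ {i} {j} e →
        decode-injective m i j (f-inj _ _ (encode-injective _ _ e)))

  abstract
    -- If the orthogonal complement of as were inside the span of ds, a vector would be
    -- determined by its products with as together with the ds-coordinates of its
    -- difference from a fixed vector with the same products. This would embed F^n into
    -- F^(m+d).
    avoid : ∀ {n m d} (as : Vec (𝕍 n) m) (ds : Vec (𝕍 n) d) → m +ℕ d < n →
            ∃ λ h → h ∈perp as × ¬ h ∈span ds
    avoid {n} {m} {d} as ds m+d<n
      with ∃Vec? 𝔽 (λ h → All.all? (λ a → ⟪ a , h ⟫ ≟F 0F) as ×-dec ¬? (h ∈span? ds))
    ... | yes found = found
    ... | no  none  = contradiction (injection⇒≤ code code-injective) (ℕ.<⇒≱ m+d<n)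
      where
      values : 𝕍 n → 𝕍 m
      values u = Vec.map (⟪_, u ⟫) as

      preimage : ∀ y → Dec (∃ λ u → values u ≡ y)
      preimage y = ∃Vec? 𝔽 λ u → _≟ᵛ_ 𝔽 (values u) y

      choose : ∀ {y} → Dec (∃ λ u → values u ≡ y) → 𝕍 n
      choose (yes (u , _)) = u
      choose (no _)        = 𝟎

      -- The fixed vector with the same products with as as u.
      rep : 𝕍 n → 𝕍 n
      rep u = choose (preimage (values u))

      rep-values : ∀ u → values (rep u) ≡ values u
      rep-values u with preimage (values u)
      ... | yes (_ , e) = e
      ... | no  ∄u      = contradiction (u , refl) ∄u

      diff : 𝕍 n → 𝕍 n
      diff u = u ⊕ (-F 1F) · rep u

      kernel : ∀ {m} (bs : Vec (𝕍 n) m) u v →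
               Vec.map (⟪_, v ⟫) bs ≡ Vec.map (⟪_, u ⟫) bs → u ⊕ (-F 1F) · v ∈perp bs
      kernel []       u v e = []
      kernel (b ∷ bs) u v e = (begin
        ⟪ b , u ⊕ (-F 1F) · v ⟫             ≡⟨ ⟪⟫-⊕ʳ b u _ ⟩
        ⟪ b , u ⟫ +F ⟪ b , (-F 1F) · v ⟫    ≡⟨ cong (_ +F_) (⟪⟫-·ʳ b _ v) ⟩
        ⟪ b , u ⟫ +F (-F 1F) *F ⟪ b , v ⟫   ≡⟨ cong (_ +F_) (RP.-1*x≈-x _) ⟩
        ⟪ b , u ⟫ +F (-F ⟪ b , v ⟫)         ≡⟨ cong (λ z → _ +F (-F z)) (Vec.∷-injectiveˡ e) ⟩
        ⟪ b , u ⟫ +F (-F ⟪ b , u ⟫)         ≡⟨ R.-‿inverseʳ _ ⟩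
        0F                                  ∎) ∷ kernel bs u v (Vec.∷-injectiveʳ e)
        where open ≡-Reasoning

      diff∈ : ∀ u → diff u ∈span ds
      diff∈ u = decidable-stable (diff u ∈span? ds) λ ∉ →
        none (diff u , kernel as u (rep u) (rep-values u) , ∉)

      code : 𝕍 n → 𝕍 (m +ℕ d)
      code u = values u ++ proj₁ (diff∈ u)

      code-injective : ∀ u v → code u ≡ code v → u ≡ v
      code-injective u v e = begin
        u                       ≡⟨ sym (⊕-redo u 1F (rep u)) ⟩
        1F · rep u ⊕ diff u     ≡⟨ cong₂ (λ r s → 1F · r ⊕ s) same-rep same-diff ⟩
        1F · rep v ⊕ diff v     ≡⟨ ⊕-redo v 1F (rep v) ⟩
        v                       ∎
        where
        open ≡-Reasoning
        halves : values u ≡ values v × proj₁ (diff∈ u) ≡ proj₁ (diff∈ v)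
        halves = Vec.++-injective (values u) (values v) e
        same-rep : rep u ≡ rep v
        same-rep = cong (λ y → choose (preimage y)) (proj₁ halves)
        same-diff : diff u ≡ diff v
        same-diff = trans (sym (proj₂ (diff∈ u)))
          (trans (cong (λ c → comb c ds) (proj₂ halves)) (proj₂ (diff∈ v)))

  abstract
    avoid₀ : ∀ {n m} (as : Vec (𝕍 n) m) → m < n → ∃ λ h → h ∈perp as × h ≢ 𝟎
    avoid₀ {n} {m} as m<n = let h , h⊥ , h∉ = avoid as [] (subst (_< n) (sym (ℕ.+-identityʳ m)) m<n) in
      h , h⊥ , λ h≡0 → h∉ ([] , sym h≡0)

  -- Since F^m is finite, an alternative valid at every vector is decided uniformly.
  abstract
    search : ∀ {m ℓ ℓ′} {A : 𝕍 m → Set ℓ} {B : 𝕍 m → Set ℓ′} →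
             (∀ h → A h ⊎ B h) → ∃ A ⊎ (∀ h → B h)
    search {A = A} {B} f with ∃Vec? 𝔽 {P = λ h → ∃ λ a → f h ≡ inj₁ a} (λ h → first? (f h))
      where
      first? : ∀ {h} (s : A h ⊎ B h) → Dec (∃ λ a → s ≡ inj₁ a)
      first? (inj₁ a) = yes (a , refl)
      first? (inj₂ _) = no λ ()
    ... | yes (h , a , _) = inj₁ (h , a)
    ... | no  none        = inj₂ λ h → remaining (f h) λ a e → none (h , a , e)
      where
      remaining : ∀ {h} (s : A h ⊎ B h) → (∀ a → s ≢ inj₁ a) → B h
      remaining (inj₁ a) ≢a = contradiction refl (≢a a)
      remaining (inj₂ b) _  = b

  -- Completing a family of vectors to a k-space

  -- Linear independence, in the form in which it occurs in bases of k-spaces.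
  Independent : ∀ {n k} → Vec (𝕍 n) k → Set
  Independent vs = ∀ c → comb c vs ≡ 𝟎 → c ≡ 𝟎

  independent-∷ : ∀ {n k} {v : 𝕍 n} {vs : Vec (𝕍 n) k} →
                  ¬ v ∈span vs → Independent vs → Independent (v ∷ vs)
  independent-∷ {v = v} {vs} v∉ ind (a ∷ c) e with a ≟F 0F
  ... | yes refl = cong (0F ∷_) (ind c (trans (sym (trans (cong (_⊕ _) (0· v)) (⊕-identityˡ _))) e))
  ... | no  a≢0  = let b , ba≡1 = inverse a≢0 in
    contradiction (subst (_∈span vs) (solve-head a b v _ ba≡1)
      (+-closed (span vs) (*-closed (span vs) b (subst (_∈span vs) (sym e) (0-closed (span vs))))
        (*-closed (span vs) (-F b) (c , refl)))) v∉

  -- Every family of vectors of U lies in the span of an independent family of vectors of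
  -- U with at most as many members.
  thin : ∀ {n j} (U : Subspace 𝔽 n) (vs : Vec (𝕍 n) j) → All (_∈ U) vs →
         ∃₂ λ i (ws : Vec (𝕍 n) i) →
           i ≤ j × Independent ws × All (_∈ U) ws × All (_∈span ws) vs
  thin U []       []       = 0 , [] , z≤n , (λ { [] _ → refl }) , [] , []
  thin U (v ∷ vs) (v∈ ∷ vs∈) with thin U vs vs∈
  ... | i , ws , i≤j , ind , ws∈ , vs⊆ with v ∈span? ws
  ... | yes v∈ws = i , ws , ℕ.m≤n⇒m≤1+n i≤j , ind , ws∈ , v∈ws ∷ vs⊆
  ... | no  v∉ws = suc i , v ∷ ws , s≤s i≤j , independent-∷ v∉ws ind , v∈ ∷ ws∈ ,
                   span-head ∷ All.map span-tail vs⊆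

  -- An independent family orthogonal to ts is enlarged by e further vectors orthogonal
  -- to ts.
  grow : ∀ {n m} (ts : Vec (𝕍 n) m) e {j} (ws : Vec (𝕍 n) j) → m +ℕ (e +ℕ j) ≤ n →
         Independent ws → All (_∈perp ts) ws →
         ∃ λ (us : Vec (𝕍 n) (e +ℕ j)) →
           Independent us × All (_∈perp ts) us × All (_∈span us) ws
  grow ts zero    ws le ind ws⊥ = ws , ind , ws⊥ , generators ws
  grow {n} {m} ts (suc e) {j} ws le ind ws⊥ =
    let lt = subst (_≤ n) (ℕ.+-suc m (e +ℕ j)) le
        us , ind′ , us⊥ , ws⊆ = grow ts e ws (ℕ.<⇒≤ lt) ind ws⊥
        u , u⊥ , u∉ = avoid ts us lt
    in u ∷ us , independent-∷ u∉ ind′ , u⊥ ∷ us⊥ , All.map span-tail ws⊆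

  -- The k-space with a given basis.
  spanned : ∀ {n k} (us : Vec (𝕍 n) k) → Independent us → J 𝔽 n k
  spanned us ind = record
    { space   = span us
    ; basis   = us
    ; isBasis = record { inside = generators us ; independent = ind ; spanning = λ _ h → h }
    }

  abstract
    -- The source of all test spaces: at most k vectors orthogonal to ts lie in a common
    -- k-space orthogonal to ts, as long as there are at most n - k vectors in ts.
    extend : ∀ {n k j m} (vs : Vec (𝕍 n) j) (ts : Vec (𝕍 n) m) → j ≤ k → m +ℕ k ≤ n →
             All (_∈perp ts) vs →
             ∃ λ (V : J 𝔽 n k) → All (_∈ space V) vs × (∀ v → v ∈ space V → v ∈perp ts)
    extend {k = k} vs ts j≤k m+k≤n vs⊥ with thin (perp ts) vs vs⊥
    ... | i , ws , i≤j , ind , ws⊥ , vs⊆ with ℕ.m≤n⇒∃[o]m+o≡n (ℕ.≤-trans i≤j j≤k)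
    ... | e , i+e≡k with trans (ℕ.+-comm e i) i+e≡k
    ... | refl =
      let us , ind′ , us⊥ , ws⊆ = grow ts e ws m+k≤n ind ws⊥
      in spanned us ind′ , All.map (span-least (span us) ws⊆) vs⊆ , λ _ → span-least (perp ts) us⊥

-- Forms as triples of a sign, a point and a slope

module Forms {q : ℕ} (𝔽 : FiniteField q) where

  open FiniteField 𝔽
  open LinearAlgebra 𝔽

  infix 4 _∈ⱽ_ _⟂_

  -- Membership of a vector in a k-space.
  _∈ⱽ_ : ∀ {n k} → 𝕍 n → J 𝔽 n k → Set
  v ∈ⱽ V = v ∈ space V

  -- The k-space V lies in the hyperplane orthogonal to h.
  _⟂_ : ∀ {n k} → 𝕍 n → J 𝔽 n k → Set
  h ⟂ V = ∀ v → v ∈ⱽ V → ⟪ h , v ⟫ ≡ 0F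

  -- The k-space contains the optional point, given by a vector spanning it.
  Through : ∀ {n k} → Maybe (𝕍 n) → J 𝔽 n k → Set
  Through nothing  V = ⊥
  Through (just p) V = p ∈ⱽ V

  -- The k-space lies in the hyperplane orthogonal to the optional slope.
  Within : ∀ {n k} → Maybe (𝕍 n) → J 𝔽 n k → Set
  Within nothing  V = ⊥
  Within (just s) V = s ⟂ V

  -- The k-spaces on which a form differs from its generic value.
  Active : ∀ {n k} → Maybe (𝕍 n) → Maybe (𝕍 n) → J 𝔽 n k → Set
  Active P S V = Through P V ⊎ Within S V

  -- The point is not orthogonal to the slope, so no k-space is active for both reasons.
  Skew : ∀ {n} → Maybe (𝕍 n) → Maybe (𝕍 n) → Set
  Skew P S = ∀ {p s} → P ≡ just p → S ≡ just s → ⟪ s , p ⟫ ≢ 0F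

-- Gluing descriptions on hyperplanes

-- The function g on the k-spaces of F^n is to be described globally. The bound on n
-- leaves room for three orthogonality conditions on a test space.
module Gluing {q : ℕ} (𝔽 : FiniteField q) {n k : ℕ} (2≤k : 2 ≤ k) (3+k≤n : 3 +ℕ k ≤ n)
              (g : J 𝔽 n k → Bool) where

  open FiniteField 𝔽
  open LinearAlgebra 𝔽
  open Forms 𝔽

  -- The k-spaces on which the function to be described is defined.
  Block : Set₁
  Block = J 𝔽 n k

  -- The value of g at V is the one prescribed by the sign ε, the point P and the
  -- slope S: it is ε for most V, and the opposite value if V is active.
  record Described (ε : Bool) (P S : Maybe (𝕍 n)) (V : J 𝔽 n k) : Set where
    field
      active   : Active P S V → g V ≡ not ε
      inactive : ¬ Active P S V → g V ≡ ε

  open Described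

  -- A description of g on the k-spaces inside the hyperplane orthogonal to h. The
  -- slope matters only modulo h, and by proper it is nonzero on that hyperplane.
  record On (h : 𝕍 n) (ε : Bool) (P S : Maybe (𝕍 n)) : Set₁ where
    field
      point-on : ∀ {p} → P ≡ just p → ⟪ h , p ⟫ ≡ 0F
      point≢𝟎  : ∀ {p} → P ≡ just p → p ≢ 𝟎
      proper   : ∀ {s} → S ≡ just s → ¬ s ∈span h ∷ []
      skew     : Skew P S
      value    : ∀ (V : Block) → h ⟂ V → Described ε P S V

  open On

  2+k≤n : 2 +ℕ k ≤ n
  2+k≤n = ℕ.<⇒≤ 3+k≤n

  5≤n : 5 ≤ n
  5≤n = ℕ.≤-trans (ℕ.+-monoʳ-≤ 3 2≤k) 3+k≤n

  abstract
    -- The instances of extend with two and with three orthogonality conditions.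
    build₂ : ∀ {j} (vs : Vec (𝕍 n) j) {h₀ h} → j ≤ k → All (_∈perp h₀ ∷ h ∷ []) vs →
             ∃ λ (V : Block) → h₀ ⟂ V × h ⟂ V × All (_∈ⱽ V) vs
    build₂ vs j≤k vs⊥ = let V , vs∈ , V⊥ = extend vs _ j≤k 2+k≤n vs⊥ in
      V , (λ v → first ∘ V⊥ v) , (λ v → second ∘ V⊥ v) , vs∈

  abstract
    build₃ : ∀ {j} (vs : Vec (𝕍 n) j) {h₀ h t} → j ≤ k → All (_∈perp h₀ ∷ h ∷ t ∷ []) vs →
             ∃ λ (V : Block) → h₀ ⟂ V × h ⟂ V × t ⟂ V × All (_∈ⱽ V) vs
    build₃ vs j≤k vs⊥ = let V , vs∈ , V⊥ = extend vs _ j≤k 3+k≤n vs⊥ in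
      V , (λ v → first ∘ V⊥ v) , (λ v → second ∘ V⊥ v) , (λ v → third ∘ V⊥ v) , vs∈

  1≤k : 1 ≤ k
  1≤k = ℕ.<⇒≤ 2≤k

  abstract
    avoid-point : ∀ (h₀ h : 𝕍 n) {p} → p ≢ 𝟎 → ∃ λ (V : Block) → h₀ ⟂ V × h ⟂ V × ¬ p ∈ⱽ V
    avoid-point h₀ h {p} p≢0 =
      let t , pt≢0 = nondegenerate p p≢0
          V , h₀⟂ , h⟂ , t⟂ , _ = build₃ [] {h₀} {h} {t} z≤n []
      in V , h₀⟂ , h⟂ , λ p∈ → pt≢0 (perp-sym t p (t⟂ p p∈))

  abstract
    -- Inside the intersection of two hyperplanes on which s₀ does not vanish there is a
    -- k-space containing a prescribed u orthogonal to s₀, not orthogonal to s₀, and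
    -- avoiding a prescribed point p off the hyperplane of s₀.
    escape : ∀ (h₀ h s₀ : 𝕍 n) {u p} → ¬ s₀ ∈span h₀ ∷ h ∷ [] → u ∈perp h₀ ∷ h ∷ s₀ ∷ [] → ⟪ s₀ , p ⟫ ≢ 0F →
             ∃ λ (V : Block) → h₀ ⟂ V × h ⟂ V × u ∈ⱽ V × ¬ s₀ ⟂ V × ¬ p ∈ⱽ V
    escape h₀ h s₀ {u} {p} s₀∉ (h₀u ∷ hu ∷ s₀u ∷ []) s₀p≢0 =
      let v , v⊥ , s₀v≢0 , p∉ = transversal
          t , t⊥ , pt≢0 = separated (v ∷ u ∷ []) p∉
          V , h₀⟂ , h⟂ , t⟂ , ∈V = build₃ (v ∷ u ∷ []) {h₀} {h} {t} 2≤k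
            ((first v⊥ ∷ second v⊥ ∷ perp-sym v t (first t⊥) ∷ []) ∷
             (h₀u ∷ hu ∷ perp-sym u t (second t⊥) ∷ []) ∷ [])
      in V , h₀⟂ , h⟂ , second ∈V , (λ s₀⟂V → s₀v≢0 (s₀⟂V v (first ∈V)))
           , λ p∈ → pt≢0 (perp-sym t p (t⟂ p p∈))
      where
      p∉u : ¬ p ∈span u ∷ []
      p∉u p∈ = s₀p≢0 (All.head (span-least (perp (s₀ ∷ [])) ((s₀u ∷ []) ∷ []) p∈))

      -- A vector v with ⟪ s₀ , v ⟫ ≢ 0 such that the plane of u and v misses p. If the
      -- first choice of v fails, v + w does, where w is orthogonal to s₀ and outside the
      -- line of u.
      transversal : ∃ λ v → v ∈perp h₀ ∷ h ∷ [] × ⟪ s₀ , v ⟫ ≢ 0F × ¬ p ∈span v ∷ u ∷ []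
      transversal with separated (h₀ ∷ h ∷ []) s₀∉
      ... | v , v⊥ , s₀v≢0 with p ∈span? (v ∷ u ∷ [])
      ... | no  p∉ = v , v⊥ , s₀v≢0 , p∉
      ... | yes p∈ with avoid (h₀ ∷ h ∷ s₀ ∷ []) (u ∷ []) 5≤n
      ... | w , (h₀w ∷ hw ∷ s₀w ∷ []) , w∉u = v+w
        , +-closed (perp (h₀ ∷ h ∷ [])) (*-closed (perp (h₀ ∷ h ∷ [])) 1F v⊥) (h₀w ∷ hw ∷ [])
        , (λ e → s₀v≢0 (trans (sym s₀v+w) e))
        , λ p∈′ → s₀v≢0 (v-kills (v∈ (w∈ (exchange p∈′ p∉u))))
        where
        v+w : 𝕍 n
        v+w = 1F · v ⊕ w
        s₀v+w : ⟪ s₀ , v+w ⟫ ≡ ⟪ s₀ , v ⟫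
        s₀v+w = trans (⟪⟫-⊕ʳ s₀ _ w) (trans (cong₂ _+F_ (cong ⟪ s₀ ,_⟫ (1· v)) s₀w) (R.+-identityʳ _))
        -- If p lay in both planes then w, being the difference of v + w and v, would
        -- lie in the plane of u and v.
        w∈ : v+w ∈span p ∷ u ∷ [] → w ∈span v ∷ u ∷ []
        w∈ h = subst (_∈span v ∷ u ∷ []) (⊕-undo w 1F v)
          (+-closed (span (v ∷ u ∷ []))
            (span-least (span (v ∷ u ∷ [])) (p∈ ∷ span-tail span-head ∷ []) h)
            (*-closed (span (v ∷ u ∷ [])) (-F 1F) span-head))
        v∈ : w ∈span v ∷ u ∷ [] → v ∈span w ∷ u ∷ []
        v∈ h = exchange h w∉u
        v-kills : v ∈span w ∷ u ∷ [] → ⟪ s₀ , v ⟫ ≡ 0F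
        v-kills h = All.head (span-least (perp (s₀ ∷ [])) ((s₀w ∷ []) ∷ (s₀u ∷ []) ∷ []) h)

  -- Comparison of two hyperplanes

  -- What the descriptions on two hyperplanes say about a k-space in both of them. If
  -- the signs differ, exactly one of the descriptions is active there; if the signs
  -- agree, both are active or neither is.
  module Pair {h₀ ε₀ P₀ S₀ h ε P S} (D₀ : On h₀ ε₀ P₀ S₀) (D : On h ε P S) where

    both-inactive : ∀ (V : Block) → h₀ ⟂ V → h ⟂ V → ε ≢ ε₀ → ¬ (¬ Active P₀ S₀ V × ¬ Active P S V)
    both-inactive V h₀⟂ h⟂ ε≢ε₀ (¬A₀ , ¬A) =
      ε≢ε₀ (trans (sym (inactive (value D V h⟂) ¬A)) (inactive (value D₀ V h₀⟂) ¬A₀))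

    both-active : ∀ (V : Block) → h₀ ⟂ V → h ⟂ V → ε ≢ ε₀ → ¬ (Active P₀ S₀ V × Active P S V)
    both-active V h₀⟂ h⟂ ε≢ε₀ (A₀ , A) =
      ε≢ε₀ (Bool.not-injective (trans (sym (active (value D V h⟂) A)) (active (value D₀ V h₀⟂) A₀)))

    forward : ∀ (V : Block) → h₀ ⟂ V → h ⟂ V → ε ≡ ε₀ → Active P₀ S₀ V → ¬ ¬ Active P S V
    forward V h₀⟂ h⟂ refl A₀ ¬A =
      Bool.not-¬ refl (trans (sym (inactive (value D V h⟂) ¬A)) (active (value D₀ V h₀⟂) A₀))

    backward : ∀ (V : Block) → h₀ ⟂ V → h ⟂ V → ε ≡ ε₀ → Active P S V → ¬ ¬ Active P₀ S₀ V
    backward V h₀⟂ h⟂ refl A ¬A₀ =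
      Bool.not-¬ refl (trans (sym (inactive (value D₀ V h₀⟂) ¬A₀)) (active (value D V h⟂) A))

    -- No k-space of the intersection goes through the point of h, or the point of h
    -- lies on the intersection and no k-space of the intersection goes through that of h₀.
    LonePoint : Set₁
    LonePoint =
      (∀ (V : Block) → h₀ ⟂ V → h ⟂ V → ¬ Through P V) ⊎
      (∃ λ p → P ≡ just p × p ∈perp h₀ ∷ h ∷ [] × (∀ (V : Block) → h₀ ⟂ V → h ⟂ V → ¬ Through P₀ V))

    -- If the signs differ, the two points cannot both lie on the intersection, since a
    -- k-space through both would be active for both descriptions.
    lone-point : ε ≢ ε₀ → LonePoint
    lone-point ε≢ε₀ = go P refl
      where
      go : ∀ Q → P ≡ Q → LonePoint
      go nothing  refl = inj₁ λ _ _ _ ()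
      go (just p) refl with ⟪ h₀ , p ⟫ ≟F 0F
      ... | no  h₀p≢0 = inj₁ λ V h₀⟂ _ p∈ → h₀p≢0 (h₀⟂ p p∈)
      ... | yes h₀p≡0 = inj₂ (p , refl , p⊥ , away P₀ refl)
        where
        p⊥ : p ∈perp h₀ ∷ h ∷ []
        p⊥ = h₀p≡0 ∷ point-on D refl ∷ []
        away : ∀ Q → P₀ ≡ Q → ∀ (V : Block) → h₀ ⟂ V → h ⟂ V → ¬ Through Q V
        away (just p₀) refl V h₀⟂ h⟂ p₀∈ =
          let W , h₀⟂W , h⟂W , ∈W = build₂ (p₀ ∷ p ∷ []) {h₀} {h} 2≤k
                ((h₀⟂ p₀ p₀∈ ∷ h⟂ p₀ p₀∈ ∷ []) ∷ p⊥ ∷ [])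
          in both-active W h₀⟂W h⟂W ε≢ε₀ (inj₁ (first ∈W) , inj₁ (second ∈W))

  -- Two descriptions without slope have the same sign: a k-space of the intersection
  -- which avoids the remaining point would be inactive for both.
  compare-flat : ∀ {h₀ ε₀ P₀ h ε P} → On h₀ ε₀ P₀ nothing → On h ε P nothing → ε ≡ ε₀
  compare-flat {h₀} {ε₀} {P₀} {h} {ε} {P} D₀ D with ε Bool.≟ ε₀
  ... | yes e    = e
  ... | no  ε≢ε₀ = ⊥-elim (clash (lone-point ε≢ε₀))
    where
    open Pair D₀ D
    miss : ∀ Q → P₀ ≡ Q → ∃ λ (V : Block) → h₀ ⟂ V × h ⟂ V × ¬ Through P₀ V
    miss (just p) refl = avoid-point h₀ h (point≢𝟎 D₀ refl)
    miss nothing  refl =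
      let V , h₀⟂ , h⟂ , _ = build₂ [] {h₀} {h} z≤n [] in V , h₀⟂ , h⟂ , λ ()
    clash : LonePoint → ⊥
    clash (inj₁ noP) =
      let V , h₀⟂ , h⟂ , ¬P₀ = miss P₀ refl
      in both-inactive V h₀⟂ h⟂ ε≢ε₀ ([ ¬P₀ , (λ ()) ]′ , [ noP V h₀⟂ h⟂ , (λ ()) ]′)
    clash (inj₂ (p , refl , _ , noP₀)) =
      let V , h₀⟂ , h⟂ , p∉ = avoid-point h₀ h (point≢𝟎 D refl)
      in both-inactive V h₀⟂ h⟂ ε≢ε₀ ([ noP₀ V h₀⟂ h⟂ , (λ ()) ]′ , [ p∉ , (λ ()) ]′)

  -- The comparison with a hyperplane h₀ that has a slope s₀, for h outside the span of
  -- h₀ and s₀.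
  module Compare {h₀ ε₀ P₀ s₀ h ε P S} (D₀ : On h₀ ε₀ P₀ (just s₀)) (D : On h ε P S)
                 (h∉ : ¬ h ∈span h₀ ∷ s₀ ∷ []) where

    open Pair D₀ D

    s₀∉ : ¬ s₀ ∈span h₀ ∷ h ∷ []
    s₀∉ s₀∈ = h∉ (swap₂ (exchange (swap₂ s₀∈) (proper D₀ refl)))

    -- A vector not orthogonal to s₀ that lies in every k-space through the point of h₀.
    decoy : ∃ λ p → ⟪ s₀ , p ⟫ ≢ 0F × (∀ (V : Block) → ¬ p ∈ⱽ V → ¬ Through P₀ V)
    decoy = go P₀ refl
      where
      go : ∀ Q → P₀ ≡ Q → ∃ λ p → ⟪ s₀ , p ⟫ ≢ 0F × (∀ (V : Block) → ¬ p ∈ⱽ V → ¬ Through Q V)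
      go (just p) refl = p , skew D₀ refl refl , λ _ → id
      go nothing  refl = let v , _ , s₀v≢0 = separated (h₀ ∷ h ∷ []) s₀∉ in v , s₀v≢0 , λ _ _ ()

    -- Through every vector of the intersection orthogonal to s₀ there is a k-space active
    -- for h₀.
    core-space : ∀ {u} → u ∈perp h₀ ∷ h ∷ s₀ ∷ [] → ∃ λ (V : Block) → h₀ ⟂ V × h ⟂ V × s₀ ⟂ V × u ∈ⱽ V
    core-space {u} u⊥ =
      let V , h₀⟂ , h⟂ , s₀⟂ , ∈V = build₃ (u ∷ []) 1≤k (u⊥ ∷ []) in V , h₀⟂ , h⟂ , s₀⟂ , first ∈V

    -- Either S restricts to a multiple of s₀ (possibly 0) on the intersection, or some u orthogonal to
    -- s₀ is contained in no k-space which S makes active.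
    Slope : Set₁
    Slope = (∃ λ s → S ≡ just s × s ∈span h ∷ h₀ ∷ s₀ ∷ []) ⊎
            (∃ λ u → u ∈perp h₀ ∷ h ∷ s₀ ∷ [] × (∀ (V : Block) → u ∈ⱽ V → ¬ Within S V))

    slope : Slope
    slope = go S refl
      where
      go : ∀ T → S ≡ T → Slope
      go nothing  refl = inj₂ (𝟎 , 0-closed (perp (h₀ ∷ h ∷ s₀ ∷ [])) , λ _ _ ())
      go (just s) refl with separate (h ∷ h₀ ∷ s₀ ∷ []) s
      ... | inj₁ s∈ = inj₁ (s , refl , s∈)
      ... | inj₂ (u , (hu ∷ h₀u ∷ s₀u ∷ []) , su≢0) =
        inj₂ (u , (h₀u ∷ hu ∷ s₀u ∷ []) , λ V u∈ s⟂ → su≢0 (s⟂ u u∈))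

    -- If the signs differed, a k-space orthogonal to s₀ would be active for h₀, so not
    -- for h; this excludes the first alternative of slope. In the second one, a k-space
    -- given by escape through u is inactive for both descriptions.
    same-sign : ε ≡ ε₀
    same-sign with ε Bool.≟ ε₀
    ... | yes e    = e
    ... | no  ε≢ε₀ = ⊥-elim (clash slope)
      where
      -- A vector not orthogonal to s₀ such that k-spaces of the intersection missing it miss
      -- both points.
      target : ∃ λ p → ⟪ s₀ , p ⟫ ≢ 0F ×
               (∀ (V : Block) → h₀ ⟂ V → h ⟂ V → ¬ p ∈ⱽ V → ¬ Through P₀ V × ¬ Through P V)
      target with lone-point ε≢ε₀
      ... | inj₁ noP = let p , s₀p≢0 , miss = decoy in
        p , s₀p≢0 , λ V h₀⟂ h⟂ p∉ → miss V p∉ , noP V h₀⟂ h⟂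
      ... | inj₂ (p , refl , (h₀p ∷ hp ∷ []) , noP₀) = p
        , (λ s₀p≡0 → let V , h₀⟂ , h⟂ , s₀⟂ , p∈ = core-space (h₀p ∷ hp ∷ s₀p≡0 ∷ [])
                     in both-active V h₀⟂ h⟂ ε≢ε₀ (inj₂ s₀⟂ , inj₁ p∈))
        , λ V h₀⟂ h⟂ p∉ → noP₀ V h₀⟂ h⟂ , p∉
      clash : Slope → ⊥
      clash (inj₁ (s , refl , s∈)) =
        let V , h₀⟂ , h⟂ , s₀⟂ , _ = core-space (0-closed (perp (h₀ ∷ h ∷ s₀ ∷ [])))
        in both-active V h₀⟂ h⟂ ε≢ε₀
             (inj₂ s₀⟂ , inj₂ λ v v∈ → perp-span (h⟂ v v∈ ∷ h₀⟂ v v∈ ∷ s₀⟂ v v∈ ∷ []) s∈)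
      clash (inj₂ (u , u⊥ , u-sees)) =
        let p , s₀p≢0 , misses = target
            V , h₀⟂ , h⟂ , u∈ , ¬s₀⟂ , p∉ = escape h₀ h s₀ s₀∉ u⊥ s₀p≢0
            noP₀ , noP = misses V h₀⟂ h⟂ p∉
        in both-inactive V h₀⟂ h⟂ ε≢ε₀ ([ noP₀ , ¬s₀⟂ ]′ , [ noP , u-sees V u∈ ]′)

    -- Through the vector u of the second alternative of slope there is a k-space which is
    -- active for h₀ and hence for h. By the choice of u it contains the point of h, which
    -- is thus orthogonal to s₀; then escape gives a k-space through this point that is
    -- active for h but not for h₀.
    same-slope : ∃ λ s → S ≡ just s × s ∈span h ∷ h₀ ∷ s₀ ∷ []
    same-slope with slope
    ... | inj₁ found = found
    ... | inj₂ (u , u⊥ , u-sees) =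
      let V , h₀⟂ , h⟂ , s₀⟂ , u∈ = core-space u⊥
      in ⊥-elim (forward V h₀⟂ h⟂ same-sign (inj₂ s₀⟂)
           [ off-point P refl V h₀⟂ h⟂ s₀⟂ , u-sees V u∈ ]′)
      where
      -- The point of h is not orthogonal to s₀.
      off-point : ∀ Q → P ≡ Q → ∀ (V : Block) → h₀ ⟂ V → h ⟂ V → s₀ ⟂ V → ¬ Through P V
      off-point (just p) refl V h₀⟂ h⟂ s₀⟂ p∈ =
        let p₀ , s₀p₀≢0 , miss = decoy
            W , h₀⟂W , h⟂W , p∈W , ¬s₀⟂W , p₀∉W = escape h₀ h s₀ s₀∉ (h₀⟂ p p∈ ∷ h⟂ p p∈ ∷ s₀⟂ p p∈ ∷ []) s₀p₀≢0
        in backward W h₀⟂W h⟂W same-sign (inj₁ p∈W) [ miss W p₀∉W , ¬s₀⟂W ]′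
      off-point nothing refl _ _ _ _ ()

  -- If two hyperplanes have the same sign and slope and the point of the first lies on
  -- the second, then it is the point of the second.
  same-point : ∀ {h h′ ε p P′ S} → On h ε (just p) S → On h′ ε P′ S → ⟪ h′ , p ⟫ ≡ 0F →
               ∃ λ p′ → P′ ≡ just p′ × p′ ∈span p ∷ []
  same-point {h} {h′} {ε} {p} {P′} {S} D D′ h′p = go P′ refl
    where
    open Pair D D′
    not-within : ∀ T → S ≡ T → ∀ (V : Block) → p ∈ⱽ V → ¬ Within S V
    not-within (just s) refl V p∈ s⟂ = skew D refl refl (s⟂ p p∈)
    not-within nothing  refl V p∈ ()

    meet : ∀ (V : Block) → h ⟂ V → h′ ⟂ V → p ∈ⱽ V → ¬ ¬ Through P′ V
    meet V h⟂ h′⟂ p∈ ¬P′ = forward V h⟂ h′⟂ refl (inj₁ p∈) [ ¬P′ , not-within S refl V p∈ ]′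

    go : ∀ Q → P′ ≡ Q → ∃ λ p′ → P′ ≡ just p′ × p′ ∈span p ∷ []
    go nothing  refl =
      let V , h⟂ , h′⟂ , ∈V = build₂ (p ∷ []) 1≤k ((point-on D refl ∷ h′p ∷ []) ∷ [])
      in ⊥-elim (meet V h⟂ h′⟂ (first ∈V) λ ())
    go (just p′) refl with separate (p ∷ []) p′
    ... | inj₁ p′∈ = p′ , refl , p′∈
    ... | inj₂ (t , (pt ∷ []) , p′t≢0) =
      let V , h⟂ , h′⟂ , t⟂ , ∈V = build₃ (p ∷ []) 1≤k
            ((point-on D refl ∷ h′p ∷ perp-sym p t pt ∷ []) ∷ [])
      in ⊥-elim (meet V h⟂ h′⟂ (first ∈V) λ p′∈ → p′t≢0 (perp-sym t p′ (t⟂ p′ p′∈)))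

  -- A description of g on all k-spaces.
  record Global : Set₁ where
    field
      ε       : Bool
      P S     : Maybe (𝕍 n)
      point≢𝟎 : ∀ {p} → P ≡ just p → p ≢ 𝟎
      slope≢𝟎 : ∀ {s} → S ≡ just s → s ≢ 𝟎
      skew    : Skew P S
      value   : ∀ (V : Block) → Described ε P S V

  ⟂-basis : ∀ {h} (V : J 𝔽 n k) → h ∈perp basis V → h ⟂ V
  ⟂-basis {h} V h⊥ v v∈ with spanning (isBasis V) v v∈
  ... | c , refl = perp-sym _ h (perp-span h⊥ (c , refl))

  -- If the hyperplanes h outside a small span have descriptions with a common sign and
  -- a common slope, their points agree and the descriptions glue.
  assemble : ∀ {d} (ds : Vec (𝕍 n) d) → k +ℕ d < n → 2 +ℕ d < n → ∀ {ε S} →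
             (∀ {s} → S ≡ just s → s ≢ 𝟎) →
             (∀ h → ¬ h ∈span ds → ∃ λ P → On h ε P S) → Global
  assemble ds k+d<n 2+d<n {ε} {S} S≢𝟎 on with search alternative
    where
    alternative : ∀ h → (¬ h ∈span ds × ∃ λ p → On h ε (just p) S) ⊎ (¬ h ∈span ds → On h ε nothing S)
    alternative h with h ∈span? ds
    ... | yes h∈ = inj₂ λ h∉ → contradiction h∈ h∉
    ... | no  h∉ with on h h∉
    ... | just p  , D = inj₁ (h∉ , p , D)
    ... | nothing , D = inj₂ λ _ → D
  ... | inj₂ pointless = record
    { ε = ε ; P = nothing ; S = S ; point≢𝟎 = λ () ; slope≢𝟎 = S≢𝟎 ; skew = λ ()
    ; value = λ V → let h , h⊥ , h∉ = avoid (basis V) ds k+d<n in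
        value (pointless h h∉) V (⟂-basis V h⊥)
    }
  ... | inj₁ (h₁ , h₁∉ , p₁ , D₁) = record
    { ε = ε ; P = just p₁ ; S = S
    ; point≢𝟎 = λ { refl → point≢𝟎 D₁ refl } ; slope≢𝟎 = S≢𝟎 ; skew = skew D₁
    ; value = λ V → let h , h⊥ , h∉ = avoid (basis V) ds k+d<n
                        P , D = on h h∉
                    in transfer D V (⟂-basis V h⊥)
    }
    where
    -- The point of any of these hyperplanes is that of h₁: both lie on a third one, h₂.
    agree : ∀ {h p} → On h ε (just p) S → p ∈span p₁ ∷ [] × p₁ ∈span p ∷ []
    agree {h} {p} D =
      let h₂ , h₂⊥ , h₂∉ = avoid (p₁ ∷ p ∷ []) ds 2+d<n
          P₂ , D₂ = on h₂ h₂∉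
          p₂ , P₂≡ , p₂∈p₁ = same-point D₁ D₂ (perp-sym p₁ h₂ (first h₂⊥))
          p₃ , P₂≡′ , p₃∈p = same-point D D₂ (perp-sym p h₂ (second h₂⊥))
          p₂∈p = subst (_∈span p ∷ []) (just-injective (trans (sym P₂≡′) P₂≡)) p₃∈p
          p₂≢0 = point≢𝟎 D₂ P₂≡
      in span-trans (span-sym p₂≢0 p₂∈p) p₂∈p₁ , span-trans (span-sym p₂≢0 p₂∈p₁) p₂∈p

    transfer : ∀ {h P} → On h ε P S → ∀ (V : Block) → h ⟂ V → Described ε (just p₁) S V
    transfer {h} {just p} D V h⟂ = record
      { active   = λ { (inj₁ p₁∈) → active (value D V h⟂) (inj₁ (span-least (space V) (p₁∈ ∷ []) p∈))
                     ; (inj₂ S⟂)  → active (value D V h⟂) (inj₂ S⟂) }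
      ; inactive = λ ¬A → inactive (value D V h⟂) λ
          { (inj₁ p∈V) → ¬A (inj₁ (span-least (space V) (p∈V ∷ []) p₁∈))
          ; (inj₂ S⟂)  → ¬A (inj₂ S⟂) }
      }
      where
      p∈  = proj₁ (agree D)
      p₁∈ = proj₂ (agree D)
    transfer {h} {nothing} D V h⟂ = record
      { active   = λ { (inj₁ p₁∈) → contradiction (proj₁ (proj₂ (same-point D₁ D (h⟂ p₁ p₁∈)))) λ ()
                     ; (inj₂ S⟂)  → active (value D V h⟂) (inj₂ S⟂) }
      ; inactive = λ ¬A → inactive (value D V h⟂) λ { (inj₂ S⟂) → ¬A (inj₂ S⟂) }
      }

  -- The slope may be replaced by any vector with the same kernel on the hyperplane.
  reslope : ∀ {h ε P s r} → On h ε P (just s) → ¬ r ∈span h ∷ [] →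
            (∀ v → ⟪ h , v ⟫ ≡ 0F → ⟪ s , v ⟫ ≡ 0F → ⟪ r , v ⟫ ≡ 0F) →
            (∀ v → ⟪ h , v ⟫ ≡ 0F → ⟪ r , v ⟫ ≡ 0F → ⟪ s , v ⟫ ≡ 0F) →
            On h ε P (just r)
  reslope D r∉ s⇒r r⇒s = record
    { point-on = point-on D
    ; point≢𝟎  = point≢𝟎 D
    ; proper   = λ { refl → r∉ }
    ; skew     = λ { refl refl rp → skew D refl refl (r⇒s _ (point-on D refl) rp) }
    ; value    = λ V h⟂ → record
      { active   = λ { (inj₁ p∈) → active (value D V h⟂) (inj₁ p∈)
                     ; (inj₂ r⟂) → active (value D V h⟂) (inj₂ λ v v∈ → r⇒s v (h⟂ v v∈) (r⟂ v v∈)) }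
      ; inactive = λ ¬A → inactive (value D V h⟂) λ
          { (inj₁ p∈) → ¬A (inj₁ p∈)
          ; (inj₂ s⟂) → ¬A (inj₂ λ v v∈ → s⇒r v (h⟂ v v∈) (s⟂ v v∈)) }
      }
    }

  -- The case in which some hyperplane h₀ has a slope s₀.
  module Sloped {h₀ ε₀ P₀ s₀} (D₀ : On h₀ ε₀ P₀ (just s₀))
                (local : ∀ h → h ≢ 𝟎 → ∃ λ ε → ∃₂ λ P S → On h ε P S) where

    -- Generators of the vectors h whose hyperplanes contain all vectors orthogonal to
    -- both h₀ and s₀.
    pencil : Vec (𝕍 n) 2
    pencil = h₀ ∷ s₀ ∷ []

    outside≢𝟎 : ∀ {h} → ¬ h ∈span pencil → h ≢ 𝟎
    outside≢𝟎 h∉ refl = h∉ (0-closed (span pencil))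

    -- Outside the span of the pencil, the slope can be chosen in it: drop the component
    -- along h.
    good : ∀ h → ¬ h ∈span pencil → ∃₂ λ P r → r ∈span pencil × On h ε₀ P (just r)
    good h h∉ with local h (outside≢𝟎 h∉)
    ... | ε , P , S , D with Compare.same-sign D₀ D h∉ | Compare.same-slope D₀ D h∉
    ... | refl | s , refl , a ∷ c , refl = P , r , (c , refl) , reslope D r∉
        (λ v hv sv → trans (sym (at v hv)) sv) (λ v hv rv → trans (at v hv) rv)
      where
      r = comb c pencil
      r∉ : ¬ r ∈span h ∷ []
      r∉ r∈ = proper D refl (+-closed (span (h ∷ [])) (*-closed (span (h ∷ [])) a span-head) r∈)
      at : ∀ v → ⟪ h , v ⟫ ≡ 0F → ⟪ a · h ⊕ r , v ⟫ ≡ ⟪ r , v ⟫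
      at v hv = trans (⟪⟫-⊕ˡ (a · h) r v) (trans (cong (_+F ⟪ r , v ⟫)
        (trans (⟪⟫-·ˡ a h v) (trans (cong (a *F_) hv) (R.zeroʳ a)))) (R.+-identityˡ _))

    -- In general position the slopes in the span of the pencil are proportional: r′ lies
    -- in the span of h′, h and r, and if it did not lie on the line of r, one of h′ and h
    -- would lie in a span excluded by general position.
    slope-unique : ∀ {h P r h′ P′ r′} → On h ε₀ P (just r) → On h′ ε₀ P′ (just r′) →
             r ∈span pencil → r′ ∈span pencil → ¬ h ∈span pencil → ¬ h′ ∈span h ∷ pencil →
             r′ ∈span r ∷ []
    slope-unique {h} {P} {r} {h′} {P′} {r′} D D′ r∈ r′∈ h∉ h′∉
      with Compare.same-slope D D′
        (λ h∈ → h′∉ (span-least (span (h ∷ pencil)) (span-head ∷ span-tail r∈ ∷ []) h∈))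
    ... | _ , refl , r′∈h′hr with r′ ∈span? (h ∷ r ∷ [])
    ... | no  r′∉ = contradiction
          (span-least (span (h ∷ pencil)) (span-tail r′∈ ∷ span-head ∷ span-tail r∈ ∷ []) (exchange r′∈h′hr r′∉)) h′∉
    ... | yes r′∈hr with r′ ∈span? (r ∷ [])
    ... | no  r′∉ = contradiction
          (span-least (span pencil) (r′∈ ∷ r∈ ∷ []) (exchange r′∈hr r′∉)) h∉
    ... | yes r′∈r = r′∈r

    slope≢𝟎 : ∀ {h P r} → On h ε₀ P (just r) → r ≢ 𝟎
    slope≢𝟎 {h} D refl = proper D refl (0-closed (span (h ∷ [])))

    global : Global
    global with avoid [] pencil (ℕ.≤-trans (s≤s (s≤s (s≤s z≤n))) 5≤n)
    ... | h₁ , _ , h₁∉ with good h₁ h₁∉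
    ... | P₁ , r₁ , r₁∈ , D₁ = assemble pencil k+2<n 5≤n (λ { refl → slope≢𝟎 D₁ }) λ h h∉ →
        let P , r , r∈ , D = good h h∉
            r∈r₁ = agree h∉ r∈ D
        in P , reslope D
             (λ r₁∈h → proper D refl (span-trans r∈r₁ r₁∈h))
             (λ v _ rv → perp-span (rv ∷ []) (span-sym (slope≢𝟎 D) r∈r₁))
             (λ v _ r₁v → perp-span (r₁v ∷ []) r∈r₁)
      where
      k+2<n : k +ℕ 2 < n
      k+2<n = subst (_< n) (ℕ.+-comm 2 k) 3+k≤n
      -- If h is not in general position to h₁, then h₂ outside the span of h₁ and the
      -- pencil is in general position to both of them.
      agree : ∀ {h P r} → ¬ h ∈span pencil → r ∈span pencil → On h ε₀ P (just r) → r ∈span r₁ ∷ []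
      agree {h} h∉ r∈ D with h ∈span? (h₁ ∷ pencil)
      ... | no  h∉₁ = slope-unique D₁ D r₁∈ r∈ h₁∉ h∉₁
      ... | yes h∈₁ with avoid [] (h₁ ∷ pencil) (ℕ.≤-trans (s≤s (s≤s (s≤s (s≤s z≤n)))) 5≤n)
      ... | h₂ , _ , h₂∉ =
        let P₂ , r₂ , r₂∈ , D₂ = good h₂ (h₂∉ ∘ span-tail)
            r₂∈r₁ = slope-unique D₁ D₂ r₁∈ r₂∈ h₁∉ h₂∉
            r₂∈r  = slope-unique D D₂ r∈ r₂∈ h∉ λ h₂∈ → h₂∉
              (span-least (span (h₁ ∷ pencil)) (h∈₁ ∷ All.map span-tail (generators pencil)) h₂∈)
        in span-trans (span-sym (slope≢𝟎 D₂) r₂∈r) r₂∈r₁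

  -- Descriptions on all hyperplanes combine to a global one. If none of them has a
  -- slope, the common slope is absent, and every nonzero h is admitted.
  glue : (∀ h → h ≢ 𝟎 → ∃ λ ε → ∃₂ λ P S → On h ε P S) → Global
  glue local with search alternative
    where
    alternative : ∀ h → (∃ λ ε → ∃₂ λ P s → On h ε P (just s)) ⊎ (h ≢ 𝟎 → ∃₂ λ ε P → On h ε P nothing)
    alternative h with _≟ᵛ_ 𝔽 h 𝟎
    ... | yes h≡0 = inj₂ λ h≢0 → contradiction h≡0 h≢0
    ... | no  h≢0 with local h h≢0
    ... | ε , P , just s  , D = inj₁ (ε , P , s , D)
    ... | ε , P , nothing , D = inj₂ λ _ → ε , P , D
  ... | inj₁ (h₀ , ε₀ , P₀ , s₀ , D₀) = Sloped.global D₀ local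
  ... | inj₂ flat with avoid₀ {n} [] (ℕ.≤-trans (s≤s z≤n) 5≤n)
  ... | h₀ , _ , h₀≢0 with flat h₀ h₀≢0
  ... | ε₀ , P₀ , D₀ = assemble [] (subst (_< n) (sym (ℕ.+-identityʳ k)) (ℕ.<⇒≤ 2+k≤n))
      (ℕ.≤-trans (s≤s (s≤s (s≤s z≤n))) 5≤n) (λ ()) λ h h∉ →
      let ε , P , D = flat h (λ { refl → h∉ ([] , refl) })
      in P , subst (λ e → On h e P nothing) (compare-flat D₀ D) D

-- Hyperplanes as coordinate spaces

module Charts {q : ℕ} (𝔽 : FiniteField q) where

  open FiniteField 𝔽
  open LinearAlgebra 𝔽
  open Forms 𝔽
  open RingSolver R.commutativeSemiring using (solve; _:+_; _:*_; _:=_)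

  -- Linear maps between coordinate spaces.
  record Linear {m n} (f : 𝕍 m → 𝕍 n) : Set where
    field
      ⊕-homo : ∀ u v → f (u ⊕ v) ≡ f u ⊕ f v
      ·-homo : ∀ a v → f (a · v) ≡ a · f v

    𝟎-homo : f 𝟎 ≡ 𝟎
    𝟎-homo = trans (cong f (sym (0· 𝟎))) (trans (·-homo 0F 𝟎) (0· _))

    comb-homo : ∀ {k} (c : 𝕍 k) vs → comb c (Vec.map f vs) ≡ f (comb c vs)
    comb-homo []      []       = sym 𝟎-homo
    comb-homo (a ∷ c) (v ∷ vs) = trans (cong₂ _⊕_ (sym (·-homo a v)) (comb-homo c vs))
      (sym (⊕-homo _ _))

  open Linear

  -- The image of a k-space under a linear map that is injective on it.
  image : ∀ {m n k} {f : 𝕍 m → 𝕍 n} → Linear f → (V : J 𝔽 m k) →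
          (∀ v → v ∈ⱽ V → f v ≡ 𝟎 → v ≡ 𝟎) → J 𝔽 n k
  image {f = f} lin V inj = record
    { space   = record
      { member   = λ w → ∃ λ v → v ∈ⱽ V × f v ≡ w
      ; 0-closed = 𝟎 , 0-closed (space V) , 𝟎-homo lin
      ; +-closed = λ { (u , u∈ , refl) (v , v∈ , refl) →
                       u ⊕ v , +-closed (space V) u∈ v∈ , ⊕-homo lin u v }
      ; *-closed = λ { a (v , v∈ , refl) → a · v , *-closed (space V) a v∈ , ·-homo lin a v }
      }
    ; basis   = Vec.map f (basis V)
    ; isBasis = record
      { inside      = All.map⁺ (All.map (λ {v} v∈ → v , v∈ , refl) (inside (isBasis V)))
      ; independent = λ c e → independent (isBasis V) c
          (inj _ (combination-closed 𝔽 (space V) (inside (isBasis V)) c) (trans (sym (comb-homo lin c _)) e))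
      ; spanning    = λ { _ (v , v∈ , refl) → let c , e = spanning (isBasis V) v v∈ in
                          c , trans (comb-homo lin c _) (cong f e) }
      }
    }

  -- Coordinates on the hyperplane orthogonal to h: φ parametrises it, ψ reads off the
  -- coordinates, and ψ* is the transpose of ψ, which extends functionals from the
  -- hyperplane to the whole space. The map ψ is defined everywhere, by forgetting one
  -- coordinate in which h does not vanish.
  record Chart {m} (h : 𝕍 (suc m)) : Set where
    field
      φ        : 𝕍 m → 𝕍 (suc m)
      ψ        : 𝕍 (suc m) → 𝕍 m
      ψ*       : 𝕍 m → 𝕍 (suc m)
      φ-linear : Linear φ
      ψ-linear : Linear ψ
      ψφ       : ∀ v → ψ (φ v) ≡ v
      φψ       : ∀ v → ⟪ h , v ⟫ ≡ 0F → φ (ψ v) ≡ v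
      φ-perp   : ∀ v → ⟪ h , φ v ⟫ ≡ 0F
      adjoint  : ∀ r v → ⟪ ψ* r , v ⟫ ≡ ⟪ r , ψ v ⟫

  -- The coordinate forgotten is the first one in which h does not vanish; on the
  -- hyperplane it is determined by the later coordinates.
  chart : ∀ {m} (h : 𝕍 (suc m)) → h ≢ 𝟎 → Chart h
  chart {m} (a ∷ h) h≢0 with a ≟F 0F
  chart {m} (a ∷ h) h≢0 | no a≢0 = record
    { φ        = λ v → e *F ⟪ h , v ⟫ ∷ v
    ; ψ        = Vec.tail
    ; ψ*       = 0F ∷_
    ; φ-linear = record
      { ⊕-homo = λ u v → cong (_∷ u ⊕ v) (trans (cong (e *F_) (⟪⟫-⊕ʳ h u v)) (R.distribˡ e _ _))
      ; ·-homo = λ c v → cong (_∷ c · v) (trans (cong (e *F_) (⟪⟫-·ʳ h c v))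
          (solve 3 (λ e c w → e :* (c :* w) := c :* (e :* w)) refl e c _))
      }
    ; ψ-linear = record
      { ⊕-homo = λ { (_ ∷ _) (_ ∷ _) → refl }
      ; ·-homo = λ { _ (_ ∷ _) → refl }
      }
    ; ψφ       = λ _ → refl
    ; φψ       = λ { (c ∷ v) hv → cong (_∷ v) (first-coordinate c v hv) }
    ; φ-perp   = λ v → trans (⟪⟫-∷ a _ h v) (trans
        (solve 3 (λ a e w → a :* (e :* w) :+ w := (e :* a) :* w :+ w) refl a e _)
        (trans (cong (λ z → z *F ⟪ h , v ⟫ +F ⟪ h , v ⟫) ea≡-1)
          (trans (cong (_+F ⟪ h , v ⟫) (RP.-1*x≈-x _)) (R.-‿inverseˡ _))))
    ; adjoint  = λ { r (c ∷ v) → trans (⟪⟫-∷ 0F c r v)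
        (trans (cong (_+F ⟪ r , v ⟫) (R.zeroˡ c)) (R.+-identityˡ _)) }
    }
    where
    -- The negative of the inverse of a.
    e : F
    e = -F proj₁ (inverse a≢0)
    ea≡-1 : e *F a ≡ -F 1F
    ea≡-1 = trans (sym (RP.-‿distribˡ-* _ a)) (cong -F_ (proj₂ (inverse a≢0)))
    -- From a c + w = 0 and e a = -1 it follows that e w = c.
    first-coordinate : ∀ c v → ⟪ a ∷ h , c ∷ v ⟫ ≡ 0F → e *F ⟪ h , v ⟫ ≡ c
    first-coordinate c v hv = begin
      e *F w                          ≡⟨ sym (R.+-identityˡ _) ⟩
      0F +F e *F w                    ≡⟨ cong (_+F e *F w) (sym (R.-‿inverseʳ c)) ⟩
      (c +F (-F c)) +F e *F w         ≡⟨ cong (λ z → (c +F z) +F e *F w) (sym (RP.-1*x≈-x c)) ⟩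
      (c +F (-F 1F) *F c) +F e *F w   ≡⟨ cong (λ z → (c +F z *F c) +F e *F w) (sym ea≡-1) ⟩
      (c +F e *F a *F c) +F e *F w    ≡⟨ solve 4 (λ c e a w → (c :+ e :* a :* c) :+ e :* w := c :+ e :* (a :* c :+ w)) refl c e a w ⟩
      c +F e *F (a *F c +F w)         ≡⟨ cong (λ z → c +F e *F z) (trans (sym (⟪⟫-∷ a c h v)) hv) ⟩
      c +F e *F 0F                    ≡⟨ cong (c +F_) (R.zeroʳ e) ⟩
      c +F 0F                         ≡⟨ R.+-identityʳ c ⟩
      c                               ∎
      where
      open ≡-Reasoning
      w : F
      w = ⟪ h , v ⟫
  chart {zero}  (a ∷ []) h≢0 | yes refl = contradiction refl h≢0
  chart {suc m} (a ∷ h)  h≢0 | yes refl = record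
    { φ        = λ v → Vec.head v ∷ φ (Vec.tail v)
    ; ψ        = λ v → Vec.head v ∷ ψ (Vec.tail v)
    ; ψ*       = λ r → Vec.head r ∷ ψ* (Vec.tail r)
    ; φ-linear = record
      { ⊕-homo = λ { (b ∷ u) (c ∷ v) → cong (b +F c ∷_) (⊕-homo φ-linear u v) }
      ; ·-homo = λ { b (c ∷ v) → cong (b *F c ∷_) (·-homo φ-linear b v) }
      }
    ; ψ-linear = record
      { ⊕-homo = λ { (b ∷ u) (c ∷ v) → cong (b +F c ∷_) (⊕-homo ψ-linear u v) }
      ; ·-homo = λ { b (c ∷ v) → cong (b *F c ∷_) (·-homo ψ-linear b v) }
      }
    ; ψφ       = λ { (c ∷ v) → cong (c ∷_) (ψφ v) }
    ; φψ       = λ { (c ∷ v) hv → cong (c ∷_) (φψ v (trans (sym (skip c v)) hv)) }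
    ; φ-perp   = λ { (c ∷ v) → trans (skip c (φ v)) (φ-perp v) }
    ; adjoint  = λ { (b ∷ r) (c ∷ v) → trans (⟪⟫-∷ b c (ψ* r) v)
        (trans (cong (b *F c +F_) (adjoint r v)) (sym (⟪⟫-∷ b c r (ψ v)))) }
    }
    where
    open Chart (chart h (h≢0 ∘ cong (0F ∷_)))
    skip : ∀ c v → ⟪ 0F ∷ h , c ∷ v ⟫ ≡ ⟪ h , v ⟫
    skip c v = trans (⟪⟫-∷ 0F c h v) (trans (cong (_+F ⟪ h , v ⟫) (R.zeroˡ c)) (R.+-identityˡ _))

  -- A map on k-spaces, for all k at once, that preserves and reflects inclusion and
  -- whose image contains all subspaces of its members.
  record Embedding (m n : ℕ) : Set₁ where
    field
      push     : ∀ {k} → J 𝔽 m k → J 𝔽 n k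
      push-⊆   : ∀ {j k} (U : J 𝔽 m j) (V : J 𝔽 m k) → _⊆_ 𝔽 U V → _⊆_ 𝔽 (push U) (push V)
      push-⊆⁻  : ∀ {j k} (U : J 𝔽 m j) (V : J 𝔽 m k) → _⊆_ 𝔽 (push U) (push V) → _⊆_ 𝔽 U V
      preimage : ∀ {j k} (U : J 𝔽 n j) (V : J 𝔽 m k) → _⊆_ 𝔽 U (push V) → ∃ λ W → _≐_ 𝔽 (push W) U

  -- The k-spaces of a hyperplane correspond to those of F^m, and so do their points and
  -- slopes.
  module Transport {m} {h : 𝕍 (suc m)} (C : Chart h) where

    open Chart C

    -- The k-space of the hyperplane with given coordinates.
    push : ∀ {k} → J 𝔽 m k → J 𝔽 (suc m) k
    push V = image φ-linear V λ v _ φv≡0 →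
      trans (sym (ψφ v)) (trans (cong ψ φv≡0) (𝟎-homo ψ-linear))

    -- The coordinates of a k-space of the hyperplane.
    pull : ∀ {k} (V : J 𝔽 (suc m) k) → h ⟂ V → J 𝔽 m k
    pull V h⟂ = image ψ-linear V λ v v∈ ψv≡0 →
      trans (sym (φψ v (h⟂ v v∈))) (trans (cong φ ψv≡0) (𝟎-homo φ-linear))

    push-⟂ : ∀ {k} (V : J 𝔽 m k) → h ⟂ push V
    push-⟂ V _ (v , _ , refl) = φ-perp v

    push-pull : ∀ {k} (V : J 𝔽 (suc m) k) (h⟂ : h ⟂ V) → _≐_ 𝔽 (push (pull V h⟂)) V
    push-pull V h⟂ =
        (λ { _ (_ , (v , v∈ , refl) , refl) → subst (_∈ⱽ V) (sym (φψ v (h⟂ v v∈))) v∈ })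
      , (λ v v∈ → ψ v , (v , v∈ , refl) , φψ v (h⟂ v v∈))

    φ-injective : ∀ {u v} → φ u ≡ φ v → u ≡ v
    φ-injective {u} {v} e = trans (sym (ψφ u)) (trans (cong ψ e) (ψφ v))

    push-∈⁻ : ∀ {k} (V : J 𝔽 m k) {v} → φ v ∈ⱽ push V → v ∈ⱽ V
    push-∈⁻ V (u , u∈ , e) = subst (_∈ⱽ V) (φ-injective e) u∈

    push-⊆ : ∀ {j k} (U : J 𝔽 m j) (V : J 𝔽 m k) → _⊆_ 𝔽 U V → _⊆_ 𝔽 (push U) (push V)
    push-⊆ U V U⊆V _ (u , u∈ , e) = u , U⊆V u u∈ , e

    push-⊆⁻ : ∀ {j k} (U : J 𝔽 m j) (V : J 𝔽 m k) → _⊆_ 𝔽 (push U) (push V) → _⊆_ 𝔽 U V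
    push-⊆⁻ U V h u u∈ = push-∈⁻ V (h (φ u) (u , u∈ , refl))

    through-pull : ∀ {k} P (V : J 𝔽 (suc m) k) (h⟂ : h ⟂ V) →
                   Through (Maybe.map φ P) V → Through P (pull V h⟂)
    through-pull (just p) V h⟂ p∈ = push-∈⁻ (pull V h⟂) (proj₂ (push-pull V h⟂) (φ p) p∈)

    through-pull⁻ : ∀ {k} P (V : J 𝔽 (suc m) k) (h⟂ : h ⟂ V) →
                    Through P (pull V h⟂) → Through (Maybe.map φ P) V
    through-pull⁻ (just p) V h⟂ p∈ = proj₁ (push-pull V h⟂) (φ p) (p , p∈ , refl)

    within-pull : ∀ {k} S (V : J 𝔽 (suc m) k) (h⟂ : h ⟂ V) →
                  Within (Maybe.map ψ* S) V → Within S (pull V h⟂)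
    within-pull (just s) V h⟂ s⟂ _ (v , v∈ , refl) = trans (sym (adjoint s v)) (s⟂ v v∈)

    within-pull⁻ : ∀ {k} S (V : J 𝔽 (suc m) k) (h⟂ : h ⟂ V) →
                   Within S (pull V h⟂) → Within (Maybe.map ψ* S) V
    within-pull⁻ (just s) V h⟂ s⟂ v v∈ = trans (adjoint s v) (s⟂ (ψ v) (v , v∈ , refl))

    map-point : ∀ P → (∀ {p} → P ≡ just p → p ≢ 𝟎) → ∀ {p} → Maybe.map φ P ≡ just p →
                ⟪ h , p ⟫ ≡ 0F × p ≢ 𝟎
    map-point (just p) p≢0 refl = φ-perp p , λ φp≡0 → p≢0 refl
      (trans (sym (ψφ p)) (trans (cong ψ φp≡0) (𝟎-homo ψ-linear)))

    -- A slope that is nonzero in coordinates is not constant zero on the hyperplane.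
    map-slope : ∀ S → (∀ {s} → S ≡ just s → s ≢ 𝟎) → ∀ {s} → Maybe.map ψ* S ≡ just s →
                ¬ s ∈span h ∷ []
    map-slope (just s) s≢0 refl ψ*s∈ =
      let v , sv≢0 = nondegenerate s (s≢0 refl) in
      sv≢0 (trans (cong ⟪ s ,_⟫ (sym (ψφ v))) (trans (sym (adjoint s (φ v)))
        (perp-span (φ-perp v ∷ []) ψ*s∈)))

    map-skew : ∀ P S → Skew P S → Skew (Maybe.map φ P) (Maybe.map ψ* S)
    map-skew (just p) (just s) skew refl refl e = skew refl refl
      (trans (cong ⟪ s ,_⟫ (sym (ψφ p))) (trans (sym (adjoint s (φ p))) e))

    embedding : Embedding m (suc m)
    embedding = record
      { push     = push
      ; push-⊆   = push-⊆
      ; push-⊆⁻  = push-⊆⁻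
      ; preimage = λ U V U⊆V → let h⟂U = λ u u∈ → push-⟂ V u (U⊆V u u∈) in
          pull U h⟂U , push-pull U h⟂U
      }

-- Real numbers and finite sums

module ℝS = Setoid ℝ-setoid

-- Reals given by equal sequences are equal.
pointwise : ∀ {a b : ℝ} → (∀ n → seq a n ≡ seq b n) → a ≈ b
pointwise {a} {b} e = mk≈ λ ε 0<ε → 0 , λ n _ →
  subst (λ d → ℚ.∣ d ∣ ℚ.< ε)
    (sym (trans (cong (ℚ._- seq b n) (e n)) (ℚ.+-inverseʳ (seq b n)))) 0<ε

+-cong : ∀ {a a′ b b′} → a ≈ a′ → b ≈ b′ → a + b ≈ a′ + b′
+-cong {a} {a′} {b} {b′} a≈ b≈ = mk≈ λ ε 0<ε →
  let 0<½ε = subst (ℚ._< ½ ℚ.* ε) (ℚ.*-zeroʳ ½) (ℚ.*-monoʳ-<-pos ½ 0<ε)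
      N , p = close a≈ (½ ℚ.* ε) 0<½ε
      M , r = close b≈ (½ ℚ.* ε) 0<½ε
  in N ℕ.⊔ M , λ n le →
    let d = seq a n ℚ.- seq a′ n ; e = seq b n ℚ.- seq b′ n in
    subst (λ z → ℚ.∣ z ∣ ℚ.< ε) (regroup (seq a n) (seq a′ n) (seq b n) (seq b′ n))
      (ℚ.≤-<-trans (ℚ.∣p+q∣≤∣p∣+∣q∣ d e)
        (subst (ℚ.∣ d ∣ ℚ.+ ℚ.∣ e ∣ ℚ.<_)
          (trans (sym (ℚ.*-distribʳ-+ ε ½ ½)) (ℚ.*-identityˡ ε))
          (ℚ.+-mono-< (p n (ℕ.m⊔n≤o⇒m≤o N M le)) (r n (ℕ.m⊔n≤o⇒n≤o N M le)))))
  where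
  open +-*-Solver
  regroup : ∀ p p′ q q′ → (p ℚ.- p′) ℚ.+ (q ℚ.- q′) ≡ (p ℚ.+ q) ℚ.- (p′ ℚ.+ q′)
  regroup = solve 4 (λ p p′ q q′ → (p :- p′) :+ (q :- q′) := (p :+ q) :- (p′ :+ q′)) refl

-- The number 0 or 1 encoded by a Boolean.
toℝ : Bool → ℝ
toℝ false = 0ℝ
toℝ true  = 1ℝ

0≉1 : ¬ 0ℝ ≈ 1ℝ
0≉1 0≈1 with close 0≈1 1ℚ (ℚ.positive⁻¹ 1ℚ)
... | N , h = ℚ.<-irrefl refl (h N ℕ.≤-refl)

toℝ-injective : ∀ {a b} → toℝ a ≈ toℝ b → a ≡ b
toℝ-injective {false} {false} _   = refl
toℝ-injective {false} {true}  0≈1 = contradiction 0≈1 0≉1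
toℝ-injective {true}  {false} 1≈0 = contradiction (ℝS.sym 1≈0) 0≉1
toℝ-injective {true}  {true}  _   = refl

indicator-yes : ∀ {a} {A : Set a} (A? : Dec A) → A → indicator A? ≡ 1ℝ
indicator-yes (yes _) _ = refl
indicator-yes (no ¬a) a = contradiction a ¬a

indicator-no : ∀ {a} {A : Set a} (A? : Dec A) → ¬ A → indicator A? ≡ 0ℝ
indicator-no (yes a) ¬a = contradiction a ¬a
indicator-no (no _)  _  = refl

*-identityʳ : ∀ r → r * 1ℝ ≈ r
*-identityʳ r = pointwise {r * 1ℝ} {r} λ n → ℚ.*-identityʳ (seq r n)

*-zeroʳ : ∀ r → r * 0ℝ ≈ 0ℝ
*-zeroʳ r = pointwise {r * 0ℝ} {0ℝ} λ n → ℚ.*-zeroʳ (seq r n)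

indicator-cong : ∀ {a b} {A : Set a} {B : Set b} (A? : Dec A) (B? : Dec B) →
                 (A → B) → (B → A) → indicator A? ≡ indicator B?
indicator-cong (yes a) B? f g = sym (indicator-yes B? (f a))
indicator-cong (no ¬a) B? f g = sym (indicator-no B? (¬a ∘ g))

indicator-01 : ∀ {a} {A : Set a} (A? : Dec A) → indicator A? ≡ 0ℝ ⊎ indicator A? ≡ 1ℝ
indicator-01 (yes _) = inj₂ refl
indicator-01 (no _)  = inj₁ refl

-- Only products with 0 and 1 occur, so congruence of multiplication is needed in
-- this form only.
*-congʳ-01 : ∀ r s d → d ≡ 0ℝ ⊎ d ≡ 1ℝ → r ≈ s → r * d ≈ s * d
*-congʳ-01 r s d (inj₁ refl) _   =
  ℝS.trans {r * 0ℝ} {0ℝ} {s * 0ℝ} (*-zeroʳ r) (ℝS.sym {s * 0ℝ} {0ℝ} (*-zeroʳ s))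
*-congʳ-01 r s d (inj₂ refl) r≈s =
  ℝS.trans {r * 1ℝ} {r} {s * 1ℝ} (*-identityʳ r)
    (ℝS.trans {r} {s} {s * 1ℝ} r≈s (ℝS.sym {s * 1ℝ} {s} (*-identityʳ s)))

*-cong-01 : ∀ r s d e → d ≡ e → d ≡ 0ℝ ⊎ d ≡ 1ℝ → r ≈ s → r * d ≈ s * e
*-cong-01 r s d e d≡e d01 r≈s = subst (λ z → r * d ≈ s * z) {d} {e} d≡e (*-congʳ-01 r s d d01 r≈s)

*-zero : ∀ r d → d ≡ 0ℝ → r * d ≈ 0ℝ
*-zero r d d≡0 = subst (λ z → r * z ≈ 0ℝ) {0ℝ} {d} (sym d≡0) (*-zeroʳ r)

-- The additive monoid of the reals.
ℝ-commutativeMonoid : CommutativeMonoid 0ℓ 0ℓ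
ℝ-commutativeMonoid = record
  { Carrier             = ℝ
  ; _≈_                 = _≈_
  ; _∙_                 = _+_
  ; ε                   = 0ℝ
  ; isCommutativeMonoid = record
    { isMonoid = record
      { isSemigroup = record
        { isMagma = record
          { isEquivalence = ℝS.isEquivalence
          ; ∙-cong        = λ {a} {a′} {b} {b′} → +-cong {a} {a′} {b} {b′}
          }
        ; assoc = λ a b c → pointwise {(a + b) + c} {a + (b + c)}
            λ n → ℚ.+-assoc (seq a n) (seq b n) (seq c n)
        }
      ; identity = (λ a → pointwise {0ℝ + a} {a} λ n → ℚ.+-identityˡ (seq a n))
                 , (λ a → pointwise {a + 0ℝ} {a} λ n → ℚ.+-identityʳ (seq a n))
      }
    ; comm = λ a b → pointwise {a + b} {b + a} λ n → ℚ.+-comm (seq a n) (seq b n)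
    }
  }

-- Sums of values of a function, in a commutative monoid, over lists without repetitions.
module Sums {c ℓ m ℓ′} (S : Setoid c ℓ) (M : CommutativeMonoid m ℓ′) where

  open Setoid S using (Carrier) renaming (_≈_ to _∼_; sym to ∼-sym; trans to ∼-trans)
  open SetoidMembership S using (_∈_)
  open UniqueSetoid S using (Unique)
  open CommutativeMonoid M using (_∙_; ε; ∙-cong; assoc; comm; identityˡ; setoid)
    renaming (Carrier to Value; _≈_ to _≋_; refl to ≋-refl; sym to ≋-sym; trans to ≋-trans)

  total : List Value → Value
  total = List.foldr _∙_ ε

  total-cong : ∀ {a} {A : Set a} {f g : A → Value} → (∀ e → f e ≋ g e) →
               ∀ as → total (List.map f as) ≋ total (List.map g as)
  total-cong f≋g []       = ≋-refl
  total-cong f≋g (e ∷ as) = ∙-cong (f≋g e) (total-cong f≋g as)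

  module _ (G : Func S setoid) where

    open Func G renaming (to to F; cong to F-cong)

    -- The sum of the values of G over a list.
    Σᴳ : List Carrier → Value
    Σᴳ as = total (List.map F as)

    Σ-zero : ∀ as → (∀ {a} → a ∈ as → F a ≋ ε) → Σᴳ as ≋ ε
    Σ-zero []       _ = ≋-refl
    Σ-zero (a ∷ as) h =
      ≋-trans (∙-cong (h (here (Setoid.refl S))) (Σ-zero as (h ∘ there))) (identityˡ ε)

    -- The result of removing the element b from the list as.
    record Removal (b : Carrier) (as : List Carrier) : Set (c Level.⊔ ℓ Level.⊔ ℓ′) where
      field
        rest        : List Carrier
        rest-unique : Unique rest
        Σ-split     : Σᴳ as ≋ F b ∙ Σᴳ rest
        ∈-rest      : ∀ {a} → a ∈ as → a ∼ b ⊎ a ∈ rest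
        rest-∈      : ∀ {a} → a ∈ rest → a ∈ as
        b∉rest      : ∀ {a} → a ∈ rest → ¬ a ∼ b

    ∉-head : ∀ {a b as} → ListAll.All (λ e → ¬ a ∼ e) as → b ∈ as → ¬ b ∼ a
    ∉-head (a≁e ∷ _) (here b∼e) b∼a = a≁e (∼-trans (∼-sym b∼a) b∼e)
    ∉-head (_ ∷ a≁)  (there b∈) b∼a = ∉-head a≁ b∈ b∼a

    remove : ∀ {b as} → Unique as → b ∈ as → Removal b as
    remove {b} {a ∷ as} (a≁ ∷ u) (here b∼a) = record
      { rest        = as
      ; rest-unique = u
      ; Σ-split     = ∙-cong (F-cong (∼-sym b∼a)) ≋-refl
      ; ∈-rest      = λ { (here e∼a) → inj₁ (∼-trans e∼a (∼-sym b∼a)) ; (there e∈) → inj₂ e∈ }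
      ; rest-∈      = there
      ; b∉rest      = λ e∈ e∼b → ∉-head a≁ e∈ (∼-trans e∼b b∼a)
      }
    remove {b} {a ∷ as} (a≁ ∷ u) (there b∈) = record
      { rest        = a ∷ rest
      ; rest-unique = all-rest rest rest-∈ ∷ rest-unique
      ; Σ-split     = ≋-trans (∙-cong ≋-refl Σ-split) (≋-trans (≋-sym (assoc _ _ _))
          (≋-trans (∙-cong (comm _ _) ≋-refl) (assoc _ _ _)))
      ; ∈-rest      = λ { (here e∼a) → inj₂ (here e∼a)
                        ; (there e∈) → [ inj₁ , inj₂ ∘ there ]′ (∈-rest e∈) }
      ; rest-∈      = λ { (here e∼a) → here e∼a ; (there e∈) → there (rest-∈ e∈) }
      ; b∉rest      = λ { (here e∼a) e∼b → ∉-head a≁ b∈ (∼-trans (∼-sym e∼b) e∼a)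
                        ; (there e∈) → b∉rest e∈ }
      }
      where
      open Removal (remove u b∈)
      all-rest : ∀ es → (∀ {e} → e ∈ es → e ∈ as) → ListAll.All (λ e → ¬ a ∼ e) es
      all-rest []       _ = []
      all-rest (e ∷ es) h =
        (λ a∼e → ∉-head a≁ (h (here (Setoid.refl S))) (∼-sym a∼e)) ∷ all-rest es (h ∘ there)

    -- A sum over as reduces to the sum over a sublist bs carrying the support.
    Σ-support : ∀ bs as → Unique bs → Unique as →
                (∀ {b} → b ∈ bs → b ∈ as) → (∀ {a} → a ∈ as → a ∈ bs ⊎ F a ≋ ε) →
                Σᴳ as ≋ Σᴳ bs
    Σ-support []       as _         _  _  supp = Σ-zero as λ a∈ → [ (λ ()) , id ]′ (supp a∈)
    Σ-support (b ∷ bs) as (b≁ ∷ ub) ua ⊆as supp =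
      ≋-trans Σ-split (∙-cong ≋-refl (Σ-support bs rest ub rest-unique bs⊆ supp′))
      where
      open Removal (remove ua (⊆as (here (Setoid.refl S))))
      bs⊆ : ∀ {e} → e ∈ bs → e ∈ rest
      bs⊆ e∈ = [ (λ e∼b → contradiction e∼b (∉-head b≁ e∈)) , id ]′ (∈-rest (⊆as (there e∈)))
      supp′ : ∀ {e} → e ∈ rest → e ∈ bs ⊎ F e ≋ ε
      supp′ e∈ with supp (rest-∈ e∈)
      ... | inj₁ (here e∼b)  = contradiction e∼b (b∉rest e∈)
      ... | inj₁ (there e∈′) = inj₁ e∈′
      ... | inj₂ z           = inj₂ z

complement≈ : ∀ d b → d ≡ toℝ b → 1ℝ - d ≈ toℝ (not b)
complement≈ _ false refl = pointwise {1ℝ - toℝ false} {toℝ true} λ _ → refl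
complement≈ _ true  refl = pointwise {1ℝ - toℝ true} {toℝ false} λ _ → refl

reflexive : ∀ c {d} → c ≡ d → c ≈ d
reflexive c refl = ℝS.refl {c}

-- Sums of two indicators which are not both one.
sum≈ : ∀ c d b b′ → c ≡ toℝ b → d ≡ toℝ b′ → b ≡ false ⊎ b′ ≡ false →
       c + d ≈ toℝ (b ∨ b′)
sum≈ _ _ false false refl refl _ = pointwise {toℝ false + toℝ false} {toℝ false} λ _ → refl
sum≈ _ _ false true  refl refl _ = pointwise {toℝ false + toℝ true} {toℝ true} λ _ → refl
sum≈ _ _ true  false refl refl _ = pointwise {toℝ true + toℝ false} {toℝ true} λ _ → refl
sum≈ _ _ true  true  refl refl = λ { (inj₁ ()) ; (inj₂ ()) }

-- The complements of such sums.
1-sum≈ : ∀ c d b b′ → c ≡ toℝ b → d ≡ toℝ b′ → b ≡ false ⊎ b′ ≡ false →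
         1ℝ - c - d ≈ toℝ (not (b ∨ b′))
1-sum≈ _ _ false false refl refl _ = pointwise {1ℝ - toℝ false - toℝ false} {toℝ true} λ _ → refl
1-sum≈ _ _ false true  refl refl _ = pointwise {1ℝ - toℝ false - toℝ true} {toℝ false} λ _ → refl
1-sum≈ _ _ true  false refl refl _ = pointwise {1ℝ - toℝ true - toℝ false} {toℝ false} λ _ → refl
1-sum≈ _ _ true  true  refl refl = λ { (inj₁ ()) ; (inj₂ ()) }

-- The Boolean encoding a real number known to be 0 or 1.
bit : ∀ {r} → r ≈ 0ℝ ⊎ r ≈ 1ℝ → Bool
bit (inj₁ _) = false
bit (inj₂ _) = true

bit-value : ∀ {r} (c : r ≈ 0ℝ ⊎ r ≈ 1ℝ) → r ≈ toℝ (bit c)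
bit-value (inj₁ r≈0) = r≈0
bit-value (inj₂ r≈1) = r≈1

-- Trivial forms and their values

module TrivialForms {q : ℕ} (𝔽 : FiniteField q) where

  open FiniteField 𝔽
  open LinearAlgebra 𝔽
  open Forms 𝔽

  -- A vector spanning the point.
  vec : ∀ {n} → Point 𝔽 n → 𝕍 n
  vec p = Vec.head (basis p)

  vec∈ : ∀ {n} (p : Point 𝔽 n) → vec p ∈ⱽ p
  vec∈ p with basis p | inside (isBasis p)
  ... | v ∷ [] | v∈ ∷ [] = v∈

  ∈⇒∈span : ∀ {n} (p : Point 𝔽 n) {v} → v ∈ⱽ p → v ∈span vec p ∷ []
  ∈⇒∈span p {v} v∈ with basis p | spanning (isBasis p) v v∈
  ... | u ∷ [] | c , e = c , e

  vec≢𝟎 : ∀ {n} (p : Point 𝔽 n) → vec p ≢ 𝟎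
  vec≢𝟎 p with basis p | independent (isBasis p)
  ... | v ∷ [] | ind = λ v≡0 → 1≢0 (cong Vec.head (ind (1F ∷ [])
    (trans (⊕-identityʳ _) (trans (1· v) v≡0))))

  point-⊆ : ∀ {n k} (p : Point 𝔽 n) (V : J 𝔽 n k) → vec p ∈ⱽ V → _⊆_ 𝔽 p V
  point-⊆ p V vec∈V v v∈ = span-least (space V) (vec∈V ∷ []) (∈⇒∈span p v∈)

  ⟂⇒⊥ : ∀ {n k} (r : Point 𝔽 n) (V : J 𝔽 n k) → vec r ⟂ V → _⊥_ 𝔽 V r
  ⟂⇒⊥ r V r⟂ v u v∈ u∈ = trans (sym (⟪⟫-def v u))
    (perp-sym u v (perp-span (r⟂ v v∈ ∷ []) (∈⇒∈span r u∈)))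

  ⊥⇒⟂ : ∀ {n k} (r : Point 𝔽 n) (V : J 𝔽 n k) → _⊥_ 𝔽 V r → vec r ⟂ V
  ⊥⇒⟂ r V V⊥r v v∈ = perp-sym v (vec r) (trans (⟪⟫-def v (vec r)) (V⊥r v (vec r) v∈ (vec∈ r)))

  -- The generic value of a trivial form, its point and its slope. Together with
  -- form-active and form-inactive these describe the form completely.
  sign : ∀ {n} → TrivialForm 𝔽 n → Bool
  sign zero          = false
  sign one           = true
  sign (Defs.x _)    = false
  sign (1-x _)       = true
  sign (Defs.y _)    = false
  sign (1-y _)       = true
  sign (x+y _ _ _)   = false
  sign (1-x-y _ _ _) = true

  point : ∀ {n} → TrivialForm 𝔽 n → Maybe (𝕍 n)
  point (Defs.x p)    = just (vec p)
  point (1-x p)       = just (vec p)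
  point (x+y p _ _)   = just (vec p)
  point (1-x-y p _ _) = just (vec p)
  point _             = nothing

  slope : ∀ {n} → TrivialForm 𝔽 n → Maybe (𝕍 n)
  slope (Defs.y r)    = just (vec r)
  slope (1-y r)       = just (vec r)
  slope (x+y _ r _)   = just (vec r)
  slope (1-x-y _ r _) = just (vec r)
  slope _             = nothing

  point≢𝟎 : ∀ {n} (t : TrivialForm 𝔽 n) {p} → point t ≡ just p → p ≢ 𝟎
  point≢𝟎 (Defs.x p)    refl = vec≢𝟎 p
  point≢𝟎 (1-x p)       refl = vec≢𝟎 p
  point≢𝟎 (x+y p _ _)   refl = vec≢𝟎 p
  point≢𝟎 (1-x-y p _ _) refl = vec≢𝟎 p

  slope≢𝟎 : ∀ {n} (t : TrivialForm 𝔽 n) {s} → slope t ≡ just s → s ≢ 𝟎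
  slope≢𝟎 (Defs.y r)    refl = vec≢𝟎 r
  slope≢𝟎 (1-y r)       refl = vec≢𝟎 r
  slope≢𝟎 (x+y _ r _)   refl = vec≢𝟎 r
  slope≢𝟎 (1-x-y _ r _) refl = vec≢𝟎 r

  skew-points : ∀ {n} (p r : Point 𝔽 n) → ¬ _⊥_ 𝔽 p r → ⟪ vec r , vec p ⟫ ≢ 0F
  skew-points p r p⊥̸r e = p⊥̸r (⟂⇒⊥ r p λ v v∈ →
    perp-sym v (vec r) (perp-span (perp-sym (vec r) (vec p) e ∷ []) (∈⇒∈span p v∈)))

  form-skew : ∀ {n} (t : TrivialForm 𝔽 n) → Skew (point t) (slope t)
  form-skew (x+y p r h)   refl refl = skew-points p r h
  form-skew (1-x-y p r h) refl refl = skew-points p r h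
  form-skew zero       ()
  form-skew one        ()
  form-skew (Defs.x _) refl ()
  form-skew (1-x _)    refl ()
  form-skew (Defs.y _) ()
  form-skew (1-y _)    ()

  module _ {n k : ℕ} where

    𝐱-yes : ∀ (p : Point 𝔽 n) (V : J 𝔽 n k) → vec p ∈ⱽ V → 𝐱 𝔽 p V ≡ 1ℝ
    𝐱-yes p V v∈ = indicator-yes (_⊆?_ 𝔽 p V) (point-⊆ p V v∈)

    𝐱-no : ∀ (p : Point 𝔽 n) (V : J 𝔽 n k) → ¬ vec p ∈ⱽ V → 𝐱 𝔽 p V ≡ 0ℝ
    𝐱-no p V v∉ = indicator-no (_⊆?_ 𝔽 p V) λ p⊆V → v∉ (p⊆V (vec p) (vec∈ p))

    𝐲-yes : ∀ (r : Point 𝔽 n) (V : J 𝔽 n k) → vec r ⟂ V → 𝐲 𝔽 r V ≡ 1ℝ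
    𝐲-yes r V r⟂ = indicator-yes (_⊥?_ 𝔽 V r) (⟂⇒⊥ r V r⟂)

    𝐲-no : ∀ (r : Point 𝔽 n) (V : J 𝔽 n k) → ¬ vec r ⟂ V → 𝐲 𝔽 r V ≡ 0ℝ
    𝐲-no r V ¬r⟂ = indicator-no (_⊥?_ 𝔽 V r) λ V⊥r → ¬r⟂ (⊥⇒⟂ r V V⊥r)

    form-active : ∀ t (V : J 𝔽 n k) → Active (point t) (slope t) V → ⟦_⟧ 𝔽 t V ≈ toℝ (not (sign t))
    form-active zero          V (inj₁ ())
    form-active zero          V (inj₂ ())
    form-active one           V (inj₁ ())
    form-active one           V (inj₂ ())
    form-active (Defs.x p)    V (inj₁ p∈) = reflexive (𝐱 𝔽 p V) (𝐱-yes p V p∈)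
    form-active (Defs.x p)    V (inj₂ ())
    form-active (1-x p)       V (inj₁ p∈) = complement≈ (𝐱 𝔽 p V) true (𝐱-yes p V p∈)
    form-active (1-x p)       V (inj₂ ())
    form-active (Defs.y r)    V (inj₁ ())
    form-active (Defs.y r)    V (inj₂ r⟂) = reflexive (𝐲 𝔽 r V) (𝐲-yes r V r⟂)
    form-active (1-y r)       V (inj₁ ())
    form-active (1-y r)       V (inj₂ r⟂) = complement≈ (𝐲 𝔽 r V) true (𝐲-yes r V r⟂)
    form-active (x+y p r h)   V (inj₁ p∈) =
      sum≈ (𝐱 𝔽 p V) (𝐲 𝔽 r V) true false (𝐱-yes p V p∈) (𝐲-no r V λ r⟂ → skew-points p r h (r⟂ _ p∈)) (inj₂ refl)
    form-active (x+y p r h)   V (inj₂ r⟂) =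
      sum≈ (𝐱 𝔽 p V) (𝐲 𝔽 r V) false true (𝐱-no p V λ p∈ → skew-points p r h (r⟂ _ p∈)) (𝐲-yes r V r⟂) (inj₁ refl)
    form-active (1-x-y p r h) V (inj₁ p∈) =
      1-sum≈ (𝐱 𝔽 p V) (𝐲 𝔽 r V) true false (𝐱-yes p V p∈) (𝐲-no r V λ r⟂ → skew-points p r h (r⟂ _ p∈)) (inj₂ refl)
    form-active (1-x-y p r h) V (inj₂ r⟂) =
      1-sum≈ (𝐱 𝔽 p V) (𝐲 𝔽 r V) false true (𝐱-no p V λ p∈ → skew-points p r h (r⟂ _ p∈)) (𝐲-yes r V r⟂) (inj₁ refl)

    form-inactive : ∀ t (V : J 𝔽 n k) → ¬ Active (point t) (slope t) V → ⟦_⟧ 𝔽 t V ≈ toℝ (sign t)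
    form-inactive zero          V ¬A = ℝS.refl {0ℝ}
    form-inactive one           V ¬A = ℝS.refl {1ℝ}
    form-inactive (Defs.x p)    V ¬A = reflexive (𝐱 𝔽 p V) (𝐱-no p V (¬A ∘ inj₁))
    form-inactive (1-x p)       V ¬A = complement≈ (𝐱 𝔽 p V) false (𝐱-no p V (¬A ∘ inj₁))
    form-inactive (Defs.y r)    V ¬A = reflexive (𝐲 𝔽 r V) (𝐲-no r V (¬A ∘ inj₂))
    form-inactive (1-y r)       V ¬A = complement≈ (𝐲 𝔽 r V) false (𝐲-no r V (¬A ∘ inj₂))
    form-inactive (x+y p r _)   V ¬A =
      sum≈ (𝐱 𝔽 p V) (𝐲 𝔽 r V) false false (𝐱-no p V (¬A ∘ inj₁)) (𝐲-no r V (¬A ∘ inj₂)) (inj₁ refl)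
    form-inactive (1-x-y p r _) V ¬A =
      1-sum≈ (𝐱 𝔽 p V) (𝐲 𝔽 r V) false false (𝐱-no p V (¬A ∘ inj₁)) (𝐲-no r V (¬A ∘ inj₂)) (inj₁ refl)

  -- A trivial form with the given sign, point and slope.
  record Realised {n} (ε : Bool) (P S : Maybe (𝕍 n)) : Set₁ where
    constructor realise
    field
      form    : TrivialForm 𝔽 n
      sign≡   : sign form ≡ ε
      point≡  : point form ≡ P
      slope≡  : slope form ≡ S

  skew-lines : ∀ {n} {p s : 𝕍 n} (p≢0 : p ≢ 𝟎) (s≢0 : s ≢ 𝟎) → ⟪ s , p ⟫ ≢ 0F →
               ¬ _⊥_ 𝔽 (line 𝔽 p p≢0) (line 𝔽 s s≢0)
  skew-lines {p = p} {s} p≢0 s≢0 sp≢0 p⊥s = sp≢0 (⊥⇒⟂ (line 𝔽 s s≢0) (line 𝔽 p p≢0) p⊥s p (1F , 1· p))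

  realised : ∀ {n} ε (P S : Maybe (𝕍 n)) → (∀ {p} → P ≡ just p → p ≢ 𝟎) →
             (∀ {s} → S ≡ just s → s ≢ 𝟎) → Skew P S → Realised ε P S
  realised false nothing  nothing  _ _ _ = realise zero refl refl refl
  realised true  nothing  nothing  _ _ _ = realise one refl refl refl
  realised false (just p) nothing  a _ _ = realise (Defs.x (line 𝔽 p (a refl))) refl refl refl
  realised true  (just p) nothing  a _ _ = realise (1-x (line 𝔽 p (a refl))) refl refl refl
  realised false nothing  (just s) _ b _ = realise (Defs.y (line 𝔽 s (b refl))) refl refl refl
  realised true  nothing  (just s) _ b _ = realise (1-y (line 𝔽 s (b refl))) refl refl refl
  realised false (just p) (just s) a b c =
    realise (x+y (line 𝔽 p (a refl)) (line 𝔽 s (b refl)) (skew-lines (a refl) (b refl) (c refl refl))) refl refl refl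
  realised true  (just p) (just s) a b c =
    realise (1-x-y (line 𝔽 p (a refl)) (line 𝔽 s (b refl)) (skew-lines (a refl) (b refl) (c refl refl))) refl refl refl

  through? : ∀ {n k} (P : Maybe (𝕍 n)) (V : J 𝔽 n k) → Dec (Through P V)
  through? nothing  V = no λ ()
  through? (just p) V = _∈ᴶ?_ 𝔽 p V

  within? : ∀ {n k} (S : Maybe (𝕍 n)) (V : J 𝔽 n k) → Dec (Within S V)
  within? nothing  V = no λ ()
  within? (just s) V = ∀Vec? 𝔽 λ v → _∈ᴶ?_ 𝔽 v V →-dec (⟪ s , v ⟫ ≟F 0F)

  active? : ∀ {n k} (P S : Maybe (𝕍 n)) (V : J 𝔽 n k) → Dec (Active P S V)
  active? P S V = through? P V ⊎-dec within? S V

-- Restriction along an embedding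

module Restriction {q : ℕ} (𝔽 : FiniteField q) where

  open Charts 𝔽
  open Func using (to) renaming (cong to to-cong)

  -- Functions on the k-spaces of F^n, restricted along an embedding of those of F^m.
  module Restrict {m n} (E : Embedding m n) where

    open Embedding E

    restrict : ∀ {k} → JFunction 𝔽 n k → JFunction 𝔽 m k
    restrict f = record
      { to   = λ V → to f (push V)
      ; cong = λ {U} {V} (U⊆V , V⊆U) → to-cong f (push-⊆ U V U⊆V , push-⊆ V U V⊆U)
      }

    module _ {k} (c : JFunction 𝔽 n 1) (V : J 𝔽 m k) where

      open Sums (J-setoid 𝔽 n 1) ℝ-commutativeMonoid
      open SetoidMembership (J-setoid 𝔽 n 1) using () renaming (_∈_ to _∈ₗ_)

      -- The terms at a point of F^n and at a point of F^m of the two sums to be compared.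
      outer : Point 𝔽 n → ℝ
      outer p = to c p * 𝐱 𝔽 p (push V)

      inner : Point 𝔽 m → ℝ
      inner p = to (restrict c) p * 𝐱 𝔽 p V

      outer-cong : ∀ {p r} → _≐_ 𝔽 p r → outer p ≈ outer r
      outer-cong {p} {r} (p⊆r , r⊆p) =
        *-cong-01 (to c p) (to c r) (𝐱 𝔽 p (push V)) (𝐱 𝔽 r (push V))
          (indicator-cong (_⊆?_ 𝔽 p (push V)) (_⊆?_ 𝔽 r (push V))
            (λ p⊆V v → p⊆V v ∘ r⊆p v) (λ r⊆V v → r⊆V v ∘ p⊆r v))
          (indicator-01 (_⊆?_ 𝔽 p (push V))) (to-cong c (p⊆r , r⊆p))

      outer-push : ∀ p → outer (push p) ≈ inner p
      outer-push p = *-cong-01 (to c (push p)) (to (restrict c) p) (𝐱 𝔽 (push p) (push V)) (𝐱 𝔽 p V)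
        (indicator-cong (_⊆?_ 𝔽 (push p) (push V)) (_⊆?_ 𝔽 p V) (push-⊆⁻ p V) (push-⊆ p V))
        (indicator-01 (_⊆?_ 𝔽 (push p) (push V))) (ℝS.refl {to c (push p)})

      outer-func : Func (J-setoid 𝔽 n 1) ℝ-setoid
      outer-func = record { to = outer ; cong = λ {p} {r} → outer-cong {p} {r} }

      -- The points of F^n that come from F^m.
      pushed : List.List (Point 𝔽 n)
      pushed = List.map push (points 𝔽 m)

      -- A point inside the embedded V comes from F^m, and any other point contributes 0.
      carried : ∀ p → Dec (_⊆_ 𝔽 p (push V)) → p ∈ₗ pushed ⊎ outer p ≈ 0ℝ
      carried p (no p⊈V)  = inj₂ (*-zero (to c p) (𝐱 𝔽 p (push V)) (indicator-no (_⊆?_ 𝔽 p (push V)) p⊈V))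
      carried p (yes p⊆V) = let p′ , p′≐p = preimage p V p⊆V in
        inj₁ (Membership.∈-resp-≈ (J-setoid 𝔽 n 1) {x = push p′} {y = p} p′≐p
          (Membership.∈-map⁺ (J-setoid 𝔽 m 1) (J-setoid 𝔽 n 1)
            (λ {p} {r} (p⊆r , r⊆p) → push-⊆ p r p⊆r , push-⊆ r p r⊆p) (points-complete 𝔽 m p′)))

      support : total (List.map outer (points 𝔽 n)) ≈ total (List.map outer pushed)
      support = Σ-support outer-func pushed (points 𝔽 n)
        (Unique.map⁺ (J-setoid 𝔽 m 1) (J-setoid 𝔽 n 1)
          (λ {p} {r} (p⊆r , r⊆p) → push-⊆⁻ p r p⊆r , push-⊆⁻ r p r⊆p) (points-unique 𝔽 m))
        (points-unique 𝔽 n)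
        (λ {p} _ → points-complete 𝔽 n p)
        (λ {p} _ → carried p (_⊆?_ 𝔽 p (push V)))

      reindex : total (List.map outer pushed) ≈ total (List.map inner (points 𝔽 m))
      reindex = subst (λ l → total l ≈ total (List.map inner (points 𝔽 m)))
        {List.map (outer ∘ push) (points 𝔽 m)} {List.map outer pushed} (List.map-∘ (points 𝔽 m))
        (total-cong {f = outer ∘ push} {g = inner} outer-push (points 𝔽 m))

      restrict-sum : total (List.map outer (points 𝔽 n)) ≈ total (List.map inner (points 𝔽 m))
      restrict-sum = ℝS.trans {total (List.map outer (points 𝔽 n))} {total (List.map outer pushed)}
        {total (List.map inner (points 𝔽 m))} support reindex

    restrict-degreeOne : ∀ {k} (f : JFunction 𝔽 n k) → DegreeOne 𝔽 f → DegreeOne 𝔽 (restrict f)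
    restrict-degreeOne f (c , f≈) = restrict c , λ V →
      ℝS.trans {to f (push V)} {sumℝ (List.map (outer c V) (points 𝔽 n))} {sumℝ (List.map (inner c V) (points 𝔽 m))}
        (f≈ (push V)) (restrict-sum c V)

-- The inductive step and the theorem

-- The step from F^m to F^(m+1) for a single function f.
module Step {q : ℕ} (𝔽 : FiniteField q) {m k : ℕ} (2≤k : 2 ≤ k) (3+k≤1+m : 3 +ℕ k ≤ suc m)
            (dot : DOT 𝔽 m k) (f : JFunction 𝔽 (suc m) k) (boolean : Boolean 𝔽 f)
            (degreeOne : DegreeOne 𝔽 f) where

  open LinearAlgebra 𝔽
  open Forms 𝔽
  open Charts 𝔽
  open TrivialForms 𝔽
  open Restriction 𝔽
  open Func using (to) renaming (cong to to-cong)

  -- The function f with values read as Booleans.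
  g : J 𝔽 (suc m) k → Bool
  g V = bit (boolean V)

  g-value : ∀ V → to f V ≈ toℝ (g V)
  g-value V = bit-value (boolean V)

  open Gluing 𝔽 2≤k 3+k≤1+m g

  -- On every hyperplane, f is a trivial form in coordinates, and this form is carried to
  -- the hyperplane by φ for its point and by ψ* for its slope.
  local : ∀ h → h ≢ 𝟎 → ∃ λ ε → ∃₂ λ P S → On h ε P S
  local h h≢0 = sign t , Maybe.map φ (point t) , Maybe.map ψ* (slope t) , record
    { point-on = λ e → proj₁ (map-point (point t) (point≢𝟎 t) e)
    ; point≢𝟎  = λ e → proj₂ (map-point (point t) (point≢𝟎 t) e)
    ; proper   = map-slope (slope t) (slope≢𝟎 t)
    ; skew     = map-skew (point t) (slope t) (form-skew t)
    ; value    = λ V h⟂ → record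
      { active   = λ A → g-is V h⟂ (not (sign t)) (form-active t (pull V h⟂)
          ([ inj₁ ∘ through-pull (point t) V h⟂ , inj₂ ∘ within-pull (slope t) V h⟂ ]′ A))
      ; inactive = λ ¬A → g-is V h⟂ (sign t) (form-inactive t (pull V h⟂)
          (¬A ∘ [ inj₁ ∘ through-pull⁻ (point t) V h⟂ , inj₂ ∘ within-pull⁻ (slope t) V h⟂ ]′))
      }
    }
    where
    C : Chart h
    C = chart h h≢0
    open Chart C
    open Transport C
    trivial : Trivial 𝔽 (Restrict.restrict embedding f)
    trivial = dot (Restrict.restrict embedding f) (λ V → boolean (push V))
      (Restrict.restrict-degreeOne embedding f degreeOne)
    t : TrivialForm 𝔽 m
    t = proj₁ trivial
    g-is : ∀ V (h⟂ : h ⟂ V) b → ⟦_⟧ 𝔽 t (pull V h⟂) ≈ toℝ b → g V ≡ b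
    g-is V h⟂ b t≈b = toℝ-injective {g V} {b}
      (ℝS.trans {toℝ (g V)} {to f V} {toℝ b} (ℝS.sym {to f V} {toℝ (g V)} (g-value V))
      (ℝS.trans {to f V} {to f (push (pull V h⟂))} {toℝ b}
        (ℝS.sym {to f (push (pull V h⟂))} {to f V} (to-cong f (push-pull V h⟂)))
      (ℝS.trans {to f (push (pull V h⟂))} {⟦_⟧ 𝔽 t (pull V h⟂)} {toℝ b}
        (proj₂ trivial (pull V h⟂)) t≈b)))

  trivial : Trivial 𝔽 f
  trivial = finish (glue local)
    where
    finish : Global → Trivial 𝔽 f
    finish G with realised (Global.ε G) (Global.P G) (Global.S G) (Global.point≢𝟎 G) (Global.slope≢𝟎 G) (Global.skew G) | Global.value G
    ... | realise t refl refl refl | value = t , λ V → agree V (active? (point t) (slope t) V)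
      where
      by : ∀ V b → g V ≡ b → ⟦_⟧ 𝔽 t V ≈ toℝ b → to f V ≈ ⟦_⟧ 𝔽 t V
      by V b g≡b t≈b = ℝS.trans {to f V} {toℝ b} {⟦_⟧ 𝔽 t V}
        (subst (λ c → to f V ≈ toℝ c) g≡b (g-value V)) (ℝS.sym {⟦_⟧ 𝔽 t V} {toℝ b} t≈b)
      agree : ∀ V → Dec (Active (point t) (slope t) V) → to f V ≈ ⟦_⟧ 𝔽 t V
      agree V (yes A) = by V (not (sign t)) (Described.active (value V) A) (form-active t V A)
      agree V (no ¬A) = by V (sign t) (Described.inactive (value V) ¬A) (form-inactive t V ¬A)

step : ∀ {q} (𝔽 : FiniteField q) {m k} → 2 ≤ k → 3 +ℕ k ≤ suc m → DOT 𝔽 m k → DOT 𝔽 (suc m) k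
step 𝔽 2≤k 3+k≤1+m dot f boolean degreeOne = Step.trivial 𝔽 2≤k 3+k≤1+m dot f boolean degreeOne

proposition4p1 : ∀ (q : ℕ) → PrimePower q → (𝔽 : FiniteField q) →
    ∀ (a b : ℕ) → 2 ≤ a → 2 ≤ b →
    DOT 𝔽 (a +ℕ b) b →
    ∀ (a′ : ℕ) → a ≤ a′ → DOT 𝔽 (a′ +ℕ b) b
proposition4p1 q _ 𝔽 a b 2≤a 2≤b dot a′ a≤a′ = climb (ℕ.≤⇒≤′ a≤a′)
  where
  climb : ∀ {a′} → a ℕ.≤′ a′ → DOT 𝔽 (a′ +ℕ b) b
  climb ℕ.≤′-refl            = dot
  climb (ℕ.≤′-step {a′} a≤′) =
    subst (λ n → DOT 𝔽 n b) {suc (a′ +ℕ b)} {suc a′ +ℕ b} refl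
      (step 𝔽 {m = a′ +ℕ b} {k = b} 2≤b
        (s≤s (ℕ.+-monoˡ-≤ b (ℕ.≤-trans 2≤a (ℕ.≤′⇒≤ a≤′)))) (climb a≤′))
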